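{- Let $S^k$ be a $k$-uniform sunflower hypergraph. If $k\ge2$ is an integer, then the characteristic polynomial of $S^k$ is $$P_A(\lambda)=(1+\lambda)^{(k-1)(k-2)}\left((2-3k+k^2)+(6-6k+k^2)\lambda+(4-2k)\lambda^2+\lambda^3\right)\left((-3+2k)+(k-3)\lambda-\lambda^2\right)^{k-2}.$$
   Context: A hypergraph $G^*=(V,E)$ has a finite vertex set $V=\{v_1,\dots,v_N\}$ and a finite set $E$ of hyperedges, each a subset of $V$. Its adjacency matrix $A=(a_{ij})$ has $a_{ij}=|\{e\in E:\{v_i,v_j\}\subset e\}|$ for $i\ne j$ and $a_{ii}=0$. The sunflower hypergraph $S^k$ is the $k$-uniform hypergraph of order $k(k-1)+1$ with vertices $v_{0,0}$ and $v_{i,j}$ ($1\le i\le k-1$, $1\le j\le k$) and hyperedges $\{v_{i,1},v_{i,2},\dots,v_{i,k}\}$ for $1\le i\le k-1$ together with $\{v_{0,0},v_{1,1},v_{2,1},\dots,v_{k-1,1}\}$. The characteristic polynomial of $S^k$ is the characteristic polynomial of its adjacency matrix $A$, written as $\det(A-\lambda I)$.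
   Formalization: With P_A(λ)=det(A−λI) the printed formula has the wrong sign for even k (for k=2 the determinant is −λ³+2λ, the formula gives λ³−2λ); the formal statement multiplies the right-hand side by (−1)^{k−1}, which leaves odd k unchanged. -}

module Defs where

open import Algebra.Bundles.Raw using (RawRing)
import Algebra.Definitions.RawSemiring as RawSemiringDefs
open import Data.Empty using (⊥-elim)
open import Data.Fin using (Fin; zero; suc; toℕ; combine; punchIn; _≟_)
open import Data.Fin.Properties using (combine-injectiveˡ; suc-injective)
open import Data.Fin.Subset using (Subset; _∈_; _∪_; ⁅_⁆; ⋃)
open import Data.Fin.Subset.Properties
  using (_⊆?_; ∉⊥; x∈⁅x⁆; x∈⁅y⁆⇒x≡y; x∈p∪q⁺; x∈p∪q⁻)
open import Data.Integer using (ℤ; +_; 0ℤ; 1ℤ)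
import Data.Integer as ℤ
open import Data.List using (List; []; _∷_; length; filter; map; tabulate)
open import Data.List.Relation.Unary.All.Properties
  using () renaming (tabulate⁺ to All-tabulate⁺)
open import Data.List.Relation.Unary.AllPairs using (_∷_)
open import Data.List.Relation.Unary.Unique.Propositional using (Unique)
open import Data.List.Relation.Unary.Unique.Propositional.Properties
  using () renaming (tabulate⁺ to Unique-tabulate⁺)
open import Data.Nat using (ℕ; zero; suc; _+_; _*_; _∸_; _≤_; s≤s; z≤n)
open import Data.Product using (∃; _,_)
open import Data.Sum using (inj₁; inj₂)
open import Level using (0ℓ)
open import Relation.Binary.PropositionalEquality
  using (_≡_; _≢_; refl; sym; subst)
open import Relation.Nullary using (yes; no)

------------------------------------------------------------------------
-- Square matrices and determinants

Matrix : ∀ {a} → Set a → ℕ → Set a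
Matrix A n = Fin n → Fin n → A

module Determinant {a ℓ} (R : RawRing a ℓ) where
  open RawRing R using (Carrier; rawSemiring; 1#; -_)
    renaming (_*_ to _·_)
  open RawSemiringDefs rawSemiring using (_^_; sum)

  -- Laplace expansion along the first row.
  det : ∀ {n} → Matrix Carrier n → Carrier
  det {zero}  M = 1#
  det {suc n} M = sum λ j →
    (- 1#) ^ toℕ j · (M zero j · det (λ r c → M (suc r) (punchIn j c)))

------------------------------------------------------------------------
-- The polynomial ring ℤ[λ]

-- Coefficients by ascending degree; trailing zeros are allowed, so
-- equality of polynomials is _≈ₚ_, not _≡_.
Poly : Set
Poly = List ℤ

coeff : Poly → ℕ → ℤ
coeff []      _       = 0ℤ
coeff (a ∷ _) zero    = a
coeff (_ ∷ p) (suc n) = coeff p n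

infix  4 _≈ₚ_
infixl 6 _+ₚ_ _-ₚ_
infixl 7 _*ₚ_
infixr 8 _^ₚ_

_≈ₚ_ : Poly → Poly → Set
p ≈ₚ q = ∀ n → coeff p n ≡ coeff q n

_+ₚ_ : Poly → Poly → Poly
[]      +ₚ q       = q
(a ∷ p) +ₚ []      = a ∷ p
(a ∷ p) +ₚ (b ∷ q) = (a ℤ.+ b) ∷ (p +ₚ q)

negₚ : Poly → Poly
negₚ = map (λ a → ℤ.- a)

_-ₚ_ : Poly → Poly → Poly
p -ₚ q = p +ₚ negₚ q

_*ₚ_ : Poly → Poly → Poly
[]      *ₚ q = []
(a ∷ p) *ₚ q = map (a ℤ.*_) q +ₚ (0ℤ ∷ (p *ₚ q))

C : ℤ → Poly
C a = a ∷ []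

-- The indeterminate λ.
X : Poly
X = 0ℤ ∷ 1ℤ ∷ []

ℤ[X] : RawRing 0ℓ 0ℓ
ℤ[X] = record
  { Carrier = Poly
  ; _≈_     = _≈ₚ_
  ; _+_     = _+ₚ_
  ; _*_     = _*ₚ_
  ; -_      = negₚ
  ; 0#      = []
  ; 1#      = C 1ℤ
  }

_^ₚ_ : Poly → ℕ → Poly
_^ₚ_ = RawSemiringDefs._^_ (RawRing.rawSemiring ℤ[X])

open Determinant ℤ[X] public using (det)

identity : ∀ {n} → Matrix ℤ n
identity i j with i ≟ j
... | yes _ = 1ℤ
... | no  _ = 0ℤ

-- det (A - λ I), not det (λ I - A): the leading coefficient is (-1)^n.
charPoly : ∀ {n} → Matrix ℤ n → Poly
charPoly A = det λ i j → C (A i j) -ₚ X *ₚ C (identity i j)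

------------------------------------------------------------------------
-- Hypergraphs

-- The vertex set is Fin order; uniqueness makes the list of hyperedges
-- a finite set.
record Hypergraph : Set where
  field
    order  : ℕ
    edges  : List (Subset order)
    unique : Unique edges

-- The number of hyperedges e with {vᵢ , vⱼ} ⊆ e off the diagonal.  The
-- inclusion is not strict: {vᵢ , vⱼ} may itself be a hyperedge.
adjacency : (G : Hypergraph) → Matrix ℤ (Hypergraph.order G)
adjacency G i j with i ≟ j
... | yes _ = 0ℤ
... | no  _ = + length (filter ((⁅ i ⁆ ∪ ⁅ j ⁆) ⊆?_) (Hypergraph.edges G))

------------------------------------------------------------------------
-- The sunflower hypergraph

sunflowerOrder : ℕ → ℕ
sunflowerOrder k = suc ((k ∸ 1) * k)

v₀₀ : ∀ k → Fin (sunflowerOrder k)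
v₀₀ k = zero

-- Indices start at 0 here: v k i j is the vertex v_{i+1,j+1}.
v : ∀ k → Fin (k ∸ 1) → Fin k → Fin (sunflowerOrder k)
v k i j = suc (combine i j)

image : ∀ {m n} → (Fin m → Fin n) → Subset n
image f = ⋃ (tabulate λ i → ⁅ f i ⁆)

petal : ∀ k → Fin (k ∸ 1) → Subset (sunflowerOrder k)
petal k i = image (v k i)

core : ∀ k → 2 ≤ k → Subset (sunflowerOrder k)
core k@(suc _) _ = ⁅ v₀₀ k ⁆ ∪ image (λ i → v k i zero)

sunflowerEdges : ∀ k → 2 ≤ k → List (Subset (sunflowerOrder k))
sunflowerEdges k 2≤k = core k 2≤k ∷ tabulate (petal k)

∈-image⁺ : ∀ {m n} (f : Fin m → Fin n) i → f i ∈ image f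
∈-image⁺ f zero    = x∈p∪q⁺ (inj₁ (x∈⁅x⁆ (f zero)))
∈-image⁺ f (suc i) = x∈p∪q⁺ (inj₂ (∈-image⁺ (λ j → f (suc j)) i))

∈-image⁻ : ∀ {m n} (f : Fin m → Fin n) {x} → x ∈ image f → ∃ λ i → x ≡ f i
∈-image⁻ {zero}  f x∈ = ⊥-elim (∉⊥ x∈)
∈-image⁻ {suc m} f x∈ with x∈p∪q⁻ ⁅ f zero ⁆ _ x∈
... | inj₁ x∈₀ = zero , x∈⁅y⁆⇒x≡y (f zero) x∈₀
... | inj₂ x∈₁ with ∈-image⁻ (λ j → f (suc j)) x∈₁
...   | i , eq = suc i , eq

petal-injective : ∀ k → 2 ≤ k → ∀ {i i′} → petal k i ≡ petal k i′ → i ≡ i′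
petal-injective k@(suc _) _ {i} {i′} eq
  with ∈-image⁻ (v k i′) (subst (v k i zero ∈_) eq (∈-image⁺ (v k i) zero))
... | j , eq′ = combine-injectiveˡ i zero i′ j (suc-injective eq′)

core≢petal : ∀ k (2≤k : 2 ≤ k) i → core k 2≤k ≢ petal k i
core≢petal k@(suc _) _ i eq
  with ∈-image⁻ (v k i)
         (subst (v₀₀ k ∈_) eq (x∈p∪q⁺ (inj₁ (x∈⁅x⁆ (v₀₀ k)))))
... | _ , ()

sunflower : (k : ℕ) → 2 ≤ k → Hypergraph
sunflower k 2≤k = record
  { order  = sunflowerOrder k
  ; edges  = sunflowerEdges k 2≤k
  ; unique = All-tabulate⁺ (core≢petal k 2≤k)
             ∷ Unique-tabulate⁺ (petal-injective k 2≤k)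
  }

{-# OPTIONS --safe #-}

-- Write t = 1 + λ.  Subtracting the column of v₀₀ from the columns of the other
-- core vertices turns A - λI into an arrow matrix: k - 1 equal diagonal blocks
-- J - tI - E₁₁, one per petal, bordered by the row and the column of v₀₀.  With
-- g = (k - 1) - t and q = -(t g + (k - 1)), such a block has determinant
-- (-t)^(k-2) q, and (-t)^(k-2) g remains after deleting the core vertex, so that
--   det (A - λI) = (-t)^((k-1)(k-2)) q^(k-2) (-λ q - (k - 1) g t).
-- The elimination is run backwards, from the identity matrix to A - λI, by column
-- operations that never divide; hence it is valid in every commutative ring.

module Submission where

open import Defs
open import Algebra.Bundles using (CommutativeRing)
import Algebra.Properties.Ring as RingProperties
import Algebra.Properties.Semiring.Exp as Exp
import Algebra.Properties.Semiring.Sum as Sum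
import Algebra.Solver.Ring as RingSolver
open import Algebra.Solver.Ring.AlmostCommutativeRing
  using (AlmostCommutativeRing; fromCommutativeRing; _-Raw-AlmostCommutative⟶_)
import Algebra.Solver.Ring.NaturalCoefficients.Default as SemiringSolver
open import Algebra.Structures using (IsCommutativeRing)
open import Data.Bool using (Bool; if_then_else_)
open import Data.Empty using (⊥-elim)
open import Data.Fin
  using (Fin; zero; suc; toℕ; inject₁; punchIn; punchOut; remQuot; combine; _≟_)
open import Data.Fin.Patterns using (0F; 1F)
open import Data.Fin.Properties
  using (punchIn-injective; punchInᵢ≢i; punchIn-punchOut; toℕ-inject₁; toℕ-injective;
         suc-injective; 0≢1+n; <-cmp; combine-remQuot; remQuot-combine;
         combine-injectiveˡ; combine-injectiveʳ)
open import Data.Fin.Subset using (Subset; _∈_; _∉_; _∪_; ⁅_⁆; _⊆_)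
open import Data.Fin.Subset.Properties
  using (_⊆?_; x∈⁅x⁆; x∈⁅y⁆⇒x≡y; x∈p∪q⁺; x∈p∪q⁻)
open import Data.Integer as ℤ using (ℤ; 0ℤ; 1ℤ; -1ℤ; +_)
import Data.Integer.Properties as ℤ
open import Data.Integer.Solver using (module +-*-Solver)
open import Data.List using ([]; _∷_; map; length; filter; tabulate)
open import Data.Maybe as Maybe using (Maybe; just; nothing)
import Data.Maybe.Properties as Maybe
open import Data.Nat as ℕ using (ℕ; zero; suc; _≤_; s≤s)
import Data.Nat.Properties as ℕ
open import Data.Nat.Tactic.RingSolver using (solve-∀)
open import Data.Product using (Σ; _,_; _×_; proj₁; proj₂; uncurry)
import Data.Product.Properties as ×
open import Data.Sum using (_⊎_; inj₁; inj₂)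
open import Function using (_∘_)
open import Function.Bundles using (Inverse; _↔_; mk↔ₛ′)
open import Level using (0ℓ; _⊔_)
open import Relation.Binary.Consequences using (dec⇒weaklyDec)
open import Relation.Binary.Definitions using (DecidableEquality; tri<; tri≈; tri>)
open import Relation.Binary.PropositionalEquality as ≡ using (_≡_; _≢_)
import Relation.Binary.Reasoning.Setoid as SetoidReasoning
open import Relation.Nullary using (yes; no; does; ¬_)
open import Relation.Unary using (Pred; Decidable)

-- Alternating multilinear forms

-- The factorisation is a Schur complement. If a petal block has determinant D, and D′ once its core
-- vertex is deleted, then the arrow has determinant D^(k-2) (-λ D - (k-1) t D′), because at each
-- core vertex the row of v₀₀ has the entry `t` and its column the entry 1. The factor D^(k-2)
-- usually comes from dividing by D. Here its powers of `q` come from the symmetry of the petals: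
-- the difference of the reduced core columns of two petals is `q` times a vector, so only one petal
-- has to be combined with v₀₀, in a 2×2 determinant.
--
-- All columns are formal combinations of vectors `e c`, one per vertex. An operation is then an
-- identity between combinations, checked in each row with the entries of `e` as indeterminates;
-- only the last evaluation takes `e` to be the identity matrix.
--
-- Columns are preferred to rows because the defining Laplace expansion runs along the first row:
-- linearity in a column, and vanishing for two equal neighbouring columns, are direct inductions.

module MultilinearForms {a ℓ} (R : CommutativeRing a ℓ) where
  open CommutativeRing R hiding (zero)
  open RingProperties ring
  open Sum semiring
  open Exp semiring using (_^_)
  open SetoidReasoning setoid

  infix 4 _≋_
  _≋_ : {J : Set} → (J → Carrier) → (J → Carrier) → Set ℓ
  u ≋ w = ∀ r → u r ≈ w r

  -- The first argument of a family I → J → Carrier is the column.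
  record MultilinearForm (I J : Set) : Set (a ⊔ ℓ) where
    field
      _≟ᴵ_   : DecidableEquality I
      form   : (I → J → Carrier) → Carrier
      cong   : ∀ {F G} → (∀ c → F c ≋ G c) → form F ≈ form G
      linear : ∀ c {F G H} α β →
               (∀ x → x ≢ c → H x ≋ F x) → (∀ x → x ≢ c → H x ≋ G x) →
               (∀ r → H c r ≈ α * F c r + β * G c r) →
               form H ≈ α * form F + β * form G

    -- Vanishing is required rather than a change of sign, which would be weaker where 2 is a zero
    -- divisor. It concerns a single pair so that, for determinants, it can first be known for
    -- neighbouring columns only.
    AlternatingAt : I → I → Set (a ⊔ ℓ)
    AlternatingAt c d = ∀ F → F c ≋ F d → form F ≈ 0#

    infixl 6 _[_≔_]
    _[_≔_] : (I → J → Carrier) → I → (J → Carrier) → I → J → Carrier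
    (F [ c ≔ u ]) x with x ≟ᴵ c
    ... | yes _ = u
    ... | no  _ = F x

    ≔-updates : ∀ F c u → (F [ c ≔ u ]) c ≋ u
    ≔-updates F c u r with c ≟ᴵ c
    ... | yes _  = refl
    ... | no c≢c = ⊥-elim (c≢c ≡.refl)

    ≔-minimal : ∀ F {c} u {x} → x ≢ c → (F [ c ≔ u ]) x ≋ F x
    ≔-minimal F {c} u {x} x≢c r with x ≟ᴵ c
    ... | yes x≡c = ⊥-elim (x≢c x≡c)
    ... | no _    = refl

    linear-≔ : ∀ H c u w α β → (∀ r → H c r ≈ α * u r + β * w r) →
               form H ≈ α * form (H [ c ≔ u ]) + β * form (H [ c ≔ w ])
    linear-≔ H c u w α β Hc = linear c α β
      (λ x x≢c r → sym (≔-minimal H u x≢c r))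
      (λ x x≢c r → sym (≔-minimal H w x≢c r))
      (λ r → trans (Hc r) (+-cong (*-congˡ (sym (≔-updates H c u r)))
                                  (*-congˡ (sym (≔-updates H c w r)))))

    module _ {c d : I} (c≢d : c ≢ d) (alternating : AlternatingAt c d)
             (F : I → J → Carrier) where
      private
        swapped : I → J → Carrier
        swapped = F [ c ≔ F d ] [ d ≔ F c ]

        -- Linearity in `c` and then in `d` gives four terms; the two with the same vector in both
        -- columns vanish.
        expand : ∀ {H} α β γ δ → (∀ x → x ≢ c → x ≢ d → H x ≋ F x) →
                 (∀ r → H c r ≈ α * F c r + β * F d r) →
                 (∀ r → H d r ≈ γ * F c r + δ * F d r) →
                 form H ≈ α * δ * form F + β * γ * form swapped
        expand {H} α β γ δ H≋F Hc Hd = begin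
          form H
            ≈⟨ linear-≔ H c (F c) (F d) α β Hc ⟩
          α * form A + β * form B
            ≈⟨ +-cong (*-congˡ (linear-≔ A d (F c) (F d) γ δ (at-d (F c))))
                      (*-congˡ (linear-≔ B d (F c) (F d) γ δ (at-d (F d)))) ⟩
          α * (γ * form (A [ d ≔ F c ]) + δ * form (A [ d ≔ F d ]))
            + β * (γ * form (B [ d ≔ F c ]) + δ * form (B [ d ≔ F d ]))
            ≈⟨ +-cong
                 (*-congˡ (+-cong (*-congˡ (repeated (F c))) (*-congˡ (cong columns-F))))
                 (*-congˡ (+-cong (*-congˡ (cong columns-swapped)) (*-congˡ (repeated (F d))))) ⟩
          α * (γ * 0# + δ * form F) + β * (γ * form swapped + δ * 0#)
            ≈⟨ +-cong (*-congˡ (trans (+-congʳ (zeroʳ γ)) (+-identityˡ _)))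
                      (*-congˡ (trans (+-congˡ (zeroʳ δ)) (+-identityʳ _))) ⟩
          α * (δ * form F) + β * (γ * form swapped)
            ≈⟨ +-cong (*-assoc α δ _) (*-assoc β γ _) ⟨
          α * δ * form F + β * γ * form swapped ∎
          where
          A B : I → J → Carrier
          A = H [ c ≔ F c ]
          B = H [ c ≔ F d ]

          at-d : ∀ u r → (H [ c ≔ u ]) d r ≈ γ * F c r + δ * F d r
          at-d u r = trans (≔-minimal H u (c≢d ∘ ≡.sym) r) (Hd r)

          repeated : ∀ u → form (H [ c ≔ u ] [ d ≔ u ]) ≈ 0#
          repeated u = alternating _ λ r →
            trans (≔-minimal (H [ c ≔ u ]) u c≢d r)
              (trans (≔-updates H c u r) (sym (≔-updates (H [ c ≔ u ]) d u r)))

          columns : ∀ u w G → G c ≋ u → G d ≋ w → (∀ x → x ≢ c → x ≢ d → G x ≋ F x) →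
                    ∀ x → (H [ c ≔ u ] [ d ≔ w ]) x ≋ G x
          columns u w G Gc Gd G≋F x r with x ≟ᴵ d
          ... | yes ≡.refl = sym (Gd r)
          ... | no x≢d with x ≟ᴵ c
          ...   | yes ≡.refl = sym (Gc r)
          ...   | no x≢c     = trans (H≋F x x≢c x≢d r) (sym (G≋F x x≢c x≢d r))

          columns-F : ∀ x → (A [ d ≔ F d ]) x ≋ F x
          columns-F = columns (F c) (F d) F (λ _ → refl) (λ _ → refl) (λ _ _ _ _ → refl)

          columns-swapped : ∀ x → (B [ d ≔ F c ]) x ≋ swapped x
          columns-swapped = columns (F d) (F c) swapped
            (λ r → trans (≔-minimal (F [ c ≔ F d ]) (F c) c≢d r) (≔-updates F c (F d) r))
            (≔-updates (F [ c ≔ F d ]) d (F c))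
            (λ x x≢c x≢d r → trans (≔-minimal (F [ c ≔ F d ]) (F c) x≢d r) (≔-minimal F (F d) x≢c r))

        -- Polarisation: with the sum of `F c` and `F d` in both columns the form vanishes, and
        -- `expand` leaves the two mixed terms.
        swapped≈- : form swapped ≈ - form F
        swapped≈- = +-inverseʳ-unique (form F) (form swapped) (begin
          form F + form swapped                        ≈⟨ +-cong (*-identityˡ _) (*-identityˡ _) ⟨
          1# * form F + 1# * form swapped
            ≈⟨ +-cong (*-congʳ (*-identityˡ 1#)) (*-congʳ (*-identityˡ 1#)) ⟨
          1# * 1# * form F + 1# * 1# * form swapped    ≈⟨ expand 1# 1# 1# 1# others Gc Gd ⟨
          form G                                       ≈⟨ alternating G (λ r → trans (Gc r) (sym (Gd r))) ⟩
          0# ∎)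
          where
          u : J → Carrier
          u r = 1# * F c r + 1# * F d r
          G : I → J → Carrier
          G = F [ c ≔ u ] [ d ≔ u ]
          Gc : G c ≋ u
          Gc r = trans (≔-minimal (F [ c ≔ u ]) u c≢d r) (≔-updates F c u r)
          Gd : G d ≋ u
          Gd = ≔-updates (F [ c ≔ u ]) d u
          others : ∀ x → x ≢ c → x ≢ d → G x ≋ F x
          others x x≢c x≢d r = trans (≔-minimal (F [ c ≔ u ]) u x≢d r) (≔-minimal F u x≢c r)

      -- Multiplicativity of the determinant for a 2×2 change of columns; no coefficient has to be a
      -- unit.
      mix-columns : ∀ {H} α β γ δ → (∀ x → x ≢ c → x ≢ d → H x ≋ F x) →
                    (∀ r → H c r ≈ α * F c r + β * F d r) →
                    (∀ r → H d r ≈ γ * F c r + δ * F d r) →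
                    form H ≈ (α * δ - β * γ) * form F
      mix-columns {H} α β γ δ H≋F Hc Hd = begin
        form H                                   ≈⟨ expand α β γ δ H≋F Hc Hd ⟩
        α * δ * form F + β * γ * form swapped    ≈⟨ +-congˡ (*-congˡ swapped≈-) ⟩
        α * δ * form F + β * γ * (- form F)      ≈⟨ +-congˡ (-‿distribʳ-* (β * γ) (form F)) ⟨
        α * δ * form F + - (β * γ * form F)      ≈⟨ +-congˡ (-‿distribˡ-* (β * γ) (form F)) ⟩
        α * δ * form F + - (β * γ) * form F      ≈⟨ distribʳ (form F) (α * δ) (- (β * γ)) ⟨
        (α * δ - β * γ) * form F ∎

      swap-columns : ∀ {H} → (∀ x → x ≢ c → x ≢ d → H x ≋ F x) → H c ≋ F d → H d ≋ F c →
                     form H ≈ - form F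
      swap-columns {H} H≋F Hc Hd = trans
        (cong lemma)
        swapped≈-
        where
        lemma : ∀ x → H x ≋ swapped x
        lemma x r with x ≟ᴵ d
        ... | yes ≡.refl = Hd r
        ... | no x≢d with x ≟ᴵ c
        ...   | yes ≡.refl = Hc r
        ...   | no x≢c     = H≋F x x≢c x≢d r

    module _ (alternating : ∀ {c d} → c ≢ d → AlternatingAt c d) where

      data Span (F : I → J → Carrier) (P : I → Set) : (J → Carrier) → Set (a ⊔ ℓ) where
        column : ∀ {d} → P d → Span F P (F d)
        zero   : Span F P (λ _ → 0#)
        add    : ∀ {u w} → Span F P u → Span F P w → Span F P (λ r → u r + w r)
        scale  : ∀ α {u} → Span F P u → Span F P (λ r → α * u r)

      -- `Span` consists of specific functions and is not closed under `≋`, so passing to another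
      -- family preserves a vector only up to `≋`.
      Span-map : ∀ {F G P Q} → (∀ {d} → P d → Q d) → (∀ {d} → P d → G d ≋ F d) →
                 ∀ {u} → Span F P u → Σ (J → Carrier) λ w → Span G Q w × u ≋ w
      Span-map {G = G} P⇒Q G≋F (column {d} Pd) = G d , column (P⇒Q Pd) , λ r → sym (G≋F Pd r)
      Span-map P⇒Q G≋F zero = _ , zero , λ _ → refl
      Span-map P⇒Q G≋F (add s s′) with Span-map P⇒Q G≋F s | Span-map P⇒Q G≋F s′
      ... | _ , z , u≋w | _ , z′ , u≋w′ = _ , add z z′ , λ r → +-cong (u≋w r) (u≋w′ r)
      Span-map P⇒Q G≋F (scale α s) with Span-map P⇒Q G≋F s
      ... | _ , z , u≋w = _ , scale α z , λ r → *-congˡ (u≋w r)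

      Span-sum : ∀ {F P n} {us : Fin n → J → Carrier} → (∀ i → Span F P (us i)) →
                 Span F P (λ r → sum (λ i → us i r))
      Span-sum {n = ℕ.zero} s = zero
      Span-sum {n = suc n}  s = add (s zero) (Span-sum (s ∘ suc))

      Span-vanishes : ∀ {F c u} → Span F (_≢ c) u → form (F [ c ≔ u ]) ≈ 0#
      Span-vanishes {F} {c} (column {d} d≢c) = alternating (d≢c ∘ ≡.sym) _ λ r →
        trans (≔-updates F c (F d) r) (sym (≔-minimal F (F d) d≢c r))
      Span-vanishes {F} {c} zero = begin
        form Z                          ≈⟨ linear-≔ Z c _ _ 0# 0# (λ r → trans (≔-updates F c _ r)
                                            (sym (trans (+-cong (zeroˡ 0#) (zeroˡ 0#)) (+-identityˡ 0#)))) ⟩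
        0# * form Z₀ + 0# * form Z₀     ≈⟨ +-cong (zeroˡ _) (zeroˡ _) ⟩
        0# + 0#                         ≈⟨ +-identityˡ 0# ⟩
        0# ∎
        where
        Z  = F [ c ≔ (λ _ → 0#) ]
        Z₀ = Z [ c ≔ (λ _ → 0#) ]
      Span-vanishes {F} {c} (add {u} {w} s s′) = begin
        form (F [ c ≔ (λ r → u r + w r) ])
          ≈⟨ linear c {F = F [ c ≔ u ]} {G = F [ c ≔ w ]} 1# 1#
               (λ x x≢c r → trans (≔-minimal F _ x≢c r) (sym (≔-minimal F u x≢c r)))
               (λ x x≢c r → trans (≔-minimal F _ x≢c r) (sym (≔-minimal F w x≢c r)))
               (λ r → trans (≔-updates F c _ r) (sym (+-cong
                  (trans (*-identityˡ _) (≔-updates F c u r))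
                  (trans (*-identityˡ _) (≔-updates F c w r))))) ⟩
        1# * form (F [ c ≔ u ]) + 1# * form (F [ c ≔ w ])
          ≈⟨ +-cong (*-congˡ (Span-vanishes s)) (*-congˡ (Span-vanishes s′)) ⟩
        1# * 0# + 1# * 0#   ≈⟨ +-cong (zeroʳ 1#) (zeroʳ 1#) ⟩
        0# + 0#             ≈⟨ +-identityˡ 0# ⟩
        0# ∎
      Span-vanishes {F} {c} (scale α {u} s) = begin
        form (F [ c ≔ (λ r → α * u r) ])
          ≈⟨ linear c {F = F [ c ≔ u ]} {G = F [ c ≔ u ]} α 0#
               (λ x x≢c r → trans (≔-minimal F _ x≢c r) (sym (≔-minimal F u x≢c r)))
               (λ x x≢c r → trans (≔-minimal F _ x≢c r) (sym (≔-minimal F u x≢c r)))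
               (λ r → trans (≔-updates F c _ r) (sym (trans
                  (+-cong (*-congˡ (≔-updates F c u r)) (zeroˡ _)) (+-identityʳ _)))) ⟩
        α * form (F [ c ≔ u ]) + 0# * form (F [ c ≔ u ])
          ≈⟨ +-cong (*-congˡ (Span-vanishes s)) (zeroˡ _) ⟩
        α * 0# + 0#         ≈⟨ trans (+-identityʳ _) (zeroʳ α) ⟩
        0# ∎

      replace-column : ∀ {F G} c α {u} → Span F (_≢ c) u →
                       (∀ x → x ≢ c → G x ≋ F x) → (∀ r → G c r ≈ α * F c r + u r) →
                       form G ≈ α * form F
      replace-column {F} {G} c α {u} s G≋F Gc = begin
        form G
          ≈⟨ linear c α 1# G≋F (λ x x≢c r → trans (G≋F x x≢c r) (sym (≔-minimal F u x≢c r)))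
               (λ r → trans (Gc r) (+-congˡ (sym (trans (*-identityˡ _) (≔-updates F c u r))))) ⟩
        α * form F + 1# * form (F [ c ≔ u ])   ≈⟨ +-congˡ (trans (*-identityˡ _) (Span-vanishes s)) ⟩
        α * form F + 0#                        ≈⟨ +-identityʳ _ ⟩
        α * form F ∎

      -- Congruence of `v` and `α * w` modulo `S`. The remainder is implicit because the derivation
      -- in `S` determines it; a column operation is thus given by a derivation and one ring
      -- identity.
      record _≈_·_+Span_ (v : J → Carrier) (α : Carrier) (w : J → Carrier)
                         (S : (J → Carrier) → Set (a ⊔ ℓ)) : Set (a ⊔ ℓ) where
        no-eta-equality
        pattern
        constructor by
        field
          {remainder} : J → Carrier
          spanned     : S remainder
          equation    : ∀ r → v r ≈ α * w r + remainder r

      -- The remainders use only columns outside the image of `h`, on which `F` and `G` agree. Hence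
      -- the replacements do not interfere and can be made one at a time, each contributing a factor
      -- `α`.
      replace-columns : ∀ n (h : Fin n → I) → (∀ {x y} → h x ≡ h y → x ≡ y) →
                        ∀ {F G} α →
                        (∀ x → G (h x) ≈ α · F (h x) +Span (Span F (λ d → ∀ y → d ≢ h y))) →
                        (∀ d → (∀ y → d ≢ h y) → G d ≋ F d) →
                        form G ≈ α ^ n * form F
      replace-columns ℕ.zero h inj α Gh G≋F =
        trans (cong λ d → G≋F d λ ()) (sym (*-identityˡ _))
      -- The intermediate family `G′` has column `h zero` from `F` and all others from `G`; the
      -- remainder carries over to it, since it avoids every `h y`.
      replace-columns (suc n) h inj {F} {G} α Gh G≋F with Gh zero
      ... | by {u} s eq with Span-map {G = G′} {Q = _≢ h zero} (λ ≢h → ≢h zero)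
                               (λ ≢h r → trans (≔-minimal G (F (h zero)) (≢h zero) r) (G≋F _ ≢h r)) s
        where G′ = G [ h zero ≔ F (h zero) ]
      ... | w , s′ , u≋w = begin
        form G                  ≈⟨ replace-column (h zero) α s′
                                     (λ x x≢h r → sym (≔-minimal G (F (h zero)) x≢h r))
                                     (λ r → trans (eq r)
                                       (+-cong (*-congˡ (sym (≔-updates G (h zero) _ r))) (u≋w r))) ⟩
        α * form G′             ≈⟨ *-congˡ (replace-columns n (h ∘ suc) (suc-injective ∘ inj) α G′h G′≋F) ⟩
        α * (α ^ n * form F)    ≈⟨ *-assoc α _ _ ⟨
        α ^ suc n * form F ∎
        where
        G′ = G [ h zero ≔ F (h zero) ]
        G′h : ∀ x → G′ (h (suc x)) ≈ α · F (h (suc x)) +Span (Span F (λ d → ∀ y → d ≢ h (suc y)))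
        G′h x with Gh (suc x)
        ... | by t eq′ with Span-map {G = F} (λ ≢h y → ≢h (suc y)) (λ _ _ → refl) t
        ...   | _ , t′ , u≋w′ = by t′ λ r →
          trans (≔-minimal G (F (h zero)) (λ hx≡h0 → 0≢1+n (≡.sym (inj hx≡h0))) r)
                (trans (eq′ r) (+-congˡ (u≋w′ r)))
        G′≋F : ∀ d → (∀ y → d ≢ h (suc y)) → G′ d ≋ F d
        G′≋F d ≢h r with d ≟ᴵ h zero
        ... | yes ≡.refl = refl
        ... | no d≢h0    = G≋F d (λ { zero → d≢h0 ; (suc y) → ≢h y }) r

-- Determinants

module DeterminantProperties {a ℓ} (R : CommutativeRing a ℓ) where
  open CommutativeRing R hiding (zero)
  open RingProperties ring
  open Sum semiring
  open Exp semiring using (_^_)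
  open SemiringSolver commutativeSemiring using (solve; _:=_; _:+_; _:*_)
  open SetoidReasoning setoid
  open MultilinearForms R
  open Determinant rawRing renaming (det to ∣_∣)

  sum-zero : ∀ {n} (u : Fin n → Carrier) → (∀ i → u i ≈ 0#) → sum u ≈ 0#
  sum-zero {n} u u≈0 = trans (sum-cong-≋ u≈0) (sum-replicate-zero n)

  private
    minor : ∀ {n} → Fin (suc n) → Matrix Carrier (suc n) → Matrix Carrier n
    minor j M r c = M (suc r) (punchIn j c)

    sign : ∀ {n} → Fin n → Carrier
    sign j = (- 1#) ^ toℕ j

    term : ∀ {n} → Matrix Carrier (suc n) → Fin (suc n) → Carrier
    term M j = sign j * (M zero j * ∣ minor j M ∣)

  det-cong : ∀ {n} {M N : Matrix Carrier n} → (∀ r → M r ≋ N r) → ∣ M ∣ ≈ ∣ N ∣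
  det-cong {ℕ.zero} M≋N = refl
  det-cong {suc n}  M≋N = sum-cong-≋ λ j →
    *-congˡ {sign j} (*-cong (M≋N zero j) (det-cong λ r c → M≋N (suc r) (punchIn j c)))

  -- In the first-row expansion the term of column `c` is linear through its entry, as its minor
  -- omits `c`; every other term is linear through its minor, by induction.
  det-linear : ∀ {n} (c : Fin n) {L M N : Matrix Carrier n} α β →
               (∀ x → x ≢ c → ∀ r → L r x ≈ M r x) → (∀ x → x ≢ c → ∀ r → L r x ≈ N r x) →
               (∀ r → L r c ≈ α * M r c + β * N r c) →
               ∣ L ∣ ≈ α * ∣ M ∣ + β * ∣ N ∣
  det-linear {suc n} c {L} {M} {N} α β L≋M L≋N Lc = begin
    sum (term L)                              ≈⟨ sum-cong-≋ terms ⟩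
    sum (λ j → α * term M j + β * term N j)   ≈⟨ ∑-distrib-+ (λ j → α * term M j) (λ j → β * term N j) ⟩
    sum (λ j → α * term M j) + sum (λ j → β * term N j)
      ≈⟨ +-cong (*-distribˡ-sum α (term M)) (*-distribˡ-sum β (term N)) ⟨
    α * sum (term M) + β * sum (term N) ∎
    where
    terms : ∀ j → term L j ≈ α * term M j + β * term N j
    terms j with j ≟ c
    ... | yes ≡.refl = begin
      sign j * (L zero j * ∣ minor j L ∣)
        ≈⟨ *-congˡ {sign j} (*-congʳ (Lc zero)) ⟩
      sign j * ((α * M zero j + β * N zero j) * ∣ minor j L ∣)
        ≈⟨ solve 6 (λ s x y d a b → s :* ((a :* x :+ b :* y) :* d) :=
               a :* (s :* (x :* d)) :+ b :* (s :* (y :* d)))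
             refl (sign j) (M zero j) (N zero j) ∣ minor j L ∣ α β ⟩
      α * (sign j * (M zero j * ∣ minor j L ∣)) + β * (sign j * (N zero j * ∣ minor j L ∣))
        ≈⟨ +-cong (*-congˡ (*-congˡ {sign j} (*-congˡ (det-cong λ r x →
                    L≋M (punchIn j x) (punchInᵢ≢i j x) (suc r)))))
                  (*-congˡ (*-congˡ {sign j} (*-congˡ (det-cong λ r x →
                    L≋N (punchIn j x) (punchInᵢ≢i j x) (suc r))))) ⟩
      α * term M j + β * term N j ∎
    ... | no j≢c = begin
      sign j * (L zero j * ∣ minor j L ∣)
        ≈⟨ *-congˡ {sign j} (*-congˡ (det-linear c′ α β
             (λ x x≢c′ r → L≋M (punchIn j x) (off x≢c′) (suc r))
             (λ x x≢c′ r → L≋N (punchIn j x) (off x≢c′) (suc r))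
             (λ r → ≡.subst (λ y → L (suc r) y ≈ α * M (suc r) y + β * N (suc r) y)
                      (≡.sym (punchIn-punchOut j≢c)) (Lc (suc r))))) ⟩
      sign j * (L zero j * (α * ∣ minor j M ∣ + β * ∣ minor j N ∣))
        ≈⟨ solve 6 (λ s x d e a b → s :* (x :* (a :* d :+ b :* e)) :=
               a :* (s :* (x :* d)) :+ b :* (s :* (x :* e)))
             refl (sign j) (L zero j) ∣ minor j M ∣ ∣ minor j N ∣ α β ⟩
      α * (sign j * (L zero j * ∣ minor j M ∣)) + β * (sign j * (L zero j * ∣ minor j N ∣))
        ≈⟨ +-cong (*-congˡ (*-congˡ {sign j} (*-congʳ (L≋M j j≢c zero))))
                  (*-congˡ (*-congˡ {sign j} (*-congʳ (L≋N j j≢c zero)))) ⟩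
      α * term M j + β * term N j ∎
      where
      c′ = punchOut j≢c
      off : ∀ {x} → x ≢ c′ → punchIn j x ≢ c
      off x≢c′ eq = x≢c′ (punchIn-injective j _ _ (≡.trans eq (≡.sym (punchIn-punchOut j≢c))))

  private
    -- The deleted column `j` is either one of the neighbours `inject₁ c` and `suc c`, or leaves
    -- both in the minor, where they are neighbours again, at `c′`.
    data Position {n} : (j : Fin (suc (suc n))) (c : Fin (suc n)) → Set where
      left  : ∀ {c} → Position (inject₁ c) c
      right : ∀ {c} → Position (suc c) c
      apart : ∀ {j c} (c′ : Fin n) → punchIn j (inject₁ c′) ≡ inject₁ c → punchIn j (suc c′) ≡ suc c →
              Position j c

    position : ∀ {n} (j : Fin (suc (suc n))) (c : Fin (suc n)) → Position j c
    position zero          zero    = left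
    position (suc zero)    zero    = right
    position {suc n} (suc (suc j)) zero    = apart zero ≡.refl ≡.refl
    position {suc n} zero          (suc c) = apart c ≡.refl ≡.refl
    position {suc n} (suc j)       (suc c) with position j c
    ... | left           = left
    ... | right          = right
    ... | apart c′ p₁ p₂ = apart (suc c′) (≡.cong suc p₁) (≡.cong suc p₂)

    -- Deleting one neighbour or the other gives enumerations that differ in one place only, and
    -- there each meets the neighbour that it kept.
    punchIn-adjacent : ∀ {n} (h : Fin (suc (suc n)) → Carrier) (c : Fin (suc n)) →
                       h (inject₁ c) ≈ h (suc c) →
                       ∀ x → h (punchIn (inject₁ c) x) ≈ h (punchIn (suc c) x)
    punchIn-adjacent h zero    eq zero    = sym eq
    punchIn-adjacent h zero    eq (suc x) = refl
    punchIn-adjacent h (suc c) eq zero    = refl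
    punchIn-adjacent {suc n} h (suc c) eq (suc x) = punchIn-adjacent (h ∘ suc) c eq x

    sum-adjacent : ∀ {n} (t : Fin (suc (suc n)) → Carrier) (c : Fin (suc n)) →
                   t (inject₁ c) + t (suc c) ≈ 0# →
                   (∀ j → j ≢ inject₁ c → j ≢ suc c → t j ≈ 0#) →
                   sum t ≈ 0#
    sum-adjacent t zero eq t≈0 = begin
      t zero + (t (suc zero) + sum (λ j → t (suc (suc j))))
        ≈⟨ +-congˡ (trans
             (+-congˡ (sum-zero (λ j → t (suc (suc j))) λ j → t≈0 (suc (suc j)) (λ ()) (λ ())))
             (+-identityʳ _)) ⟩
      t zero + t (suc zero) ≈⟨ eq ⟩
      0# ∎
    sum-adjacent {suc n} t (suc c) eq t≈0 = begin
      t zero + sum (t ∘ suc)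
        ≈⟨ +-cong (t≈0 zero (λ ()) (λ ()))
                  (sum-adjacent (t ∘ suc) c eq λ j j≢ j≢′ →
                    t≈0 (suc j) (j≢ ∘ suc-injective) (j≢′ ∘ suc-injective)) ⟩
      0# + 0# ≈⟨ +-identityˡ 0# ⟩
      0# ∎

  -- The two terms that delete one of the equal columns have equal minors and opposite signs; every
  -- other minor still contains equal neighbours.
  det-adjacent : ∀ {n} (c : Fin n) (M : Matrix Carrier (suc n)) →
                 (∀ r → M r (inject₁ c) ≈ M r (suc c)) → ∣ M ∣ ≈ 0#
  det-adjacent {suc n} c M eq = sum-adjacent (term M) c cancel others
    where
    cancel : term M (inject₁ c) + term M (suc c) ≈ 0#
    cancel = begin
      term M (inject₁ c) + term M (suc c)
        ≈⟨ +-congʳ (*-cong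
             (reflexive (≡.cong ((- 1#) ^_) (toℕ-inject₁ c)))
             (*-cong (eq zero) (det-cong λ r → punchIn-adjacent (M (suc r)) c (eq (suc r))))) ⟩
      s * D + (- 1# * s) * D   ≈⟨ +-congˡ (trans (*-assoc (- 1#) s D) (-1*x≈-x (s * D))) ⟩
      s * D - s * D            ≈⟨ -‿inverseʳ (s * D) ⟩
      0# ∎
      where
      s = (- 1#) ^ toℕ c
      D = M zero (suc c) * ∣ minor (suc c) M ∣
    others : ∀ j → j ≢ inject₁ c → j ≢ suc c → term M j ≈ 0#
    others j j≢ j≢′ with position j c
    ... | left           = ⊥-elim (j≢ ≡.refl)
    ... | right          = ⊥-elim (j≢′ ≡.refl)
    ... | apart c′ p₁ p₂ = begin
      sign j * (M zero j * ∣ minor j M ∣)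
        ≈⟨ *-congˡ {sign j} (*-congˡ (det-adjacent c′ (minor j M) λ r →
             ≡.subst₂ (λ x y → M (suc r) x ≈ M (suc r) y) (≡.sym p₁) (≡.sym p₂) (eq (suc r)))) ⟩
      sign j * (M zero j * 0#)  ≈⟨ *-congˡ {sign j} (zeroʳ _) ⟩
      sign j * 0#               ≈⟨ zeroʳ _ ⟩
      0# ∎

  det-form : ∀ n → MultilinearForm (Fin n) (Fin n)
  det-form n = record
    { _≟ᴵ_   = _≟_
    ; form   = λ F → ∣ (λ r c → F c r) ∣
    ; cong   = λ F≋G → det-cong λ r c → F≋G c r
    ; linear = λ c α β H≋F H≋G Hc → det-linear c α β H≋F H≋G Hc
    }

  -- Moving the second of two equal columns towards the first by swapping neighbours.
  det-alternating-< : ∀ {n} e (c d : Fin n) → toℕ d ≡ suc (e ℕ.+ toℕ c) →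
                      MultilinearForm.AlternatingAt (det-form n) c d
  det-alternating-< ℕ.zero c (suc d′) d≡ F eq = det-adjacent d′ (λ r x → F x r) λ r →
    trans (reflexive (≡.cong (λ x → F x r) d′≡c)) (eq r)
    where
    d′≡c : inject₁ d′ ≡ c
    d′≡c = toℕ-injective (≡.trans (toℕ-inject₁ d′) (ℕ.suc-injective d≡))
  det-alternating-< {suc n} (suc e) c (suc d′) d≡ F eq = begin
    form F        ≈⟨ -‿involutive (form F) ⟨
    - - form F    ≈⟨ -‿cong swapped ⟨
    - form F′     ≈⟨ -‿cong (det-alternating-< e c d₀ d₀≡ F′ F′c≋F′d₀) ⟩
    - 0#          ≈⟨ -0#≈0# ⟩
    0# ∎
    where
    open MultilinearForm (det-form (suc n))
    d₀ = inject₁ d′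
    d₁ = suc d′
    F′ = F [ d₀ ≔ F d₁ ] [ d₁ ≔ F d₀ ]
    d₀≡ : toℕ d₀ ≡ suc (e ℕ.+ toℕ c)
    d₀≡ = ≡.trans (toℕ-inject₁ d′) (ℕ.suc-injective d≡)
    d₀≢d₁ : d₀ ≢ d₁
    d₀≢d₁ d₀≡d₁ = ℕ.1+n≢n (≡.trans (≡.cong toℕ (≡.sym d₀≡d₁)) (toℕ-inject₁ d′))
    c≢d₀ : c ≢ d₀
    c≢d₀ c≡d₀ = ℕ.m≢1+n+m (toℕ c) (≡.trans (≡.cong toℕ c≡d₀) d₀≡)
    c≢d₁ : c ≢ d₁
    c≢d₁ c≡d₁ = ℕ.m≢1+n+m (toℕ c) (≡.trans (≡.cong toℕ c≡d₁) d≡)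
    F′d₀ : F′ d₀ ≋ F d₁
    F′d₀ r = trans (≔-minimal _ _ d₀≢d₁ r) (≔-updates F d₀ _ r)
    swapped : form F′ ≈ - form F
    swapped = swap-columns d₀≢d₁ (λ G G≋ → det-adjacent d′ (λ r x → G x r) G≋) F
      (λ x x≢d₀ x≢d₁ r → trans (≔-minimal _ _ x≢d₁ r) (≔-minimal F _ x≢d₀ r))
      F′d₀ (≔-updates _ d₁ _)
    F′c≋F′d₀ : F′ c ≋ F′ d₀
    F′c≋F′d₀ r = trans (trans (≔-minimal _ _ c≢d₁ r) (≔-minimal F _ c≢d₀ r)) (trans (eq r) (sym (F′d₀ r)))

  private
    difference : ∀ {m n} → m ℕ.< n → n ≡ suc (n ℕ.∸ suc m ℕ.+ m)
    difference {m} {n} m<n = ≡.trans (≡.sym (ℕ.m∸n+n≡m m<n)) (ℕ.+-suc (n ℕ.∸ suc m) m)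

  det-alternating : ∀ {n} {c d : Fin n} → c ≢ d → MultilinearForm.AlternatingAt (det-form n) c d
  det-alternating {c = c} {d} c≢d F eq with <-cmp c d
  ... | tri≈ _ c≡d _ = ⊥-elim (c≢d c≡d)
  ... | tri< c<d _ _ = det-alternating-< _ c d (difference c<d) F eq
  ... | tri> _ _ d<c = det-alternating-< _ d c (difference d<c) F λ r → sym (eq r)

  -- Identity matrices and determinants over other index types

  δ : ∀ {I : Set} → DecidableEquality I → I → I → Carrier
  δ _≟_ i j = if does (i ≟ j) then 1# else 0#

  det-identity : ∀ n → ∣ δ {Fin n} _≟_ ∣ ≈ 1#
  det-identity ℕ.zero  = refl
  det-identity (suc n) = begin
    1# * (1# * ∣ δ {Fin n} _≟_ ∣) + sum (term (δ {Fin (suc n)} _≟_) ∘ suc)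
      ≈⟨ +-cong (trans (*-identityˡ _) (trans (*-identityˡ _) (det-identity n)))
                (sum-zero (term (δ {Fin (suc n)} _≟_) ∘ suc) λ j →
                  trans (*-congˡ {sign (suc j)} (zeroˡ _)) (zeroʳ _)) ⟩
    1# + 0#  ≈⟨ +-identityʳ 1# ⟩
    1# ∎

  module _ {n} {I : Set} (_≟ᴵ_ : DecidableEquality I) (Fin↔I : Fin n ↔ I) where
    open Inverse Fin↔I using (to; from; strictlyInverseˡ; strictlyInverseʳ)

    -- Rows and columns are relabelled by the same bijection, so the sign of the relabelling cancels
    -- and the identity matrix keeps determinant 1. Column operations can then be written on
    -- vertices, without ordering them.
    reindexed-det : MultilinearForm I I
    reindexed-det = record
      { _≟ᴵ_   = _≟ᴵ_
      ; form   = λ F → ∣ (λ r c → F (to c) (to r)) ∣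
      ; cong   = λ F≋G → det-cong λ r c → F≋G (to c) (to r)
      ; linear = λ c {F} {G} {H} α β H≋F H≋G Hc → det-linear (from c) α β
          (λ x x≢ r → H≋F (to x) (x≢ ∘ to≡⇒≡from) (to r))
          (λ x x≢ r → H≋G (to x) (x≢ ∘ to≡⇒≡from) (to r))
          (Hc′ c {F} {G} {H} Hc)
      }
      where
      to≡⇒≡from : ∀ {x c} → to x ≡ c → x ≡ from c
      to≡⇒≡from to≡ = ≡.trans (≡.sym (strictlyInverseʳ _)) (≡.cong from to≡)
      Hc′ : ∀ c {F G H : I → I → Carrier} {α β} → (∀ r → H c r ≈ α * F c r + β * G c r) →
            ∀ r → H (to (from c)) (to r) ≈ α * F (to (from c)) (to r) + β * G (to (from c)) (to r)
      Hc′ c Hc r rewrite strictlyInverseˡ c = Hc (to r)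

    reindexed-det-alternating : ∀ {c d} → c ≢ d → MultilinearForm.AlternatingAt reindexed-det c d
    reindexed-det-alternating {c} {d} c≢d F eq =
      det-alternating
        (λ from≡ → c≢d (≡.trans (≡.sym (strictlyInverseˡ c)) (≡.trans (≡.cong to from≡) (strictlyInverseˡ d))))
        (λ x r → F (to x) (to r))
        λ r → ≡.subst₂ (λ x y → F x (to r) ≈ F y (to r))
          (≡.sym (strictlyInverseˡ c)) (≡.sym (strictlyInverseˡ d)) (eq (to r))

    to-injective : ∀ {r c} → to r ≡ to c → r ≡ c
    to-injective {r} {c} tr≡tc =
      ≡.trans (≡.sym (strictlyInverseʳ r)) (≡.trans (≡.cong from tr≡tc) (strictlyInverseʳ c))

    reindexed-det-identity : MultilinearForm.form reindexed-det (δ _≟ᴵ_) ≈ 1#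
    reindexed-det-identity = trans (det-cong δ≈δ) (det-identity n)
      where
      δ≈δ : ∀ r c → δ _≟ᴵ_ (to c) (to r) ≈ δ _≟_ r c
      δ≈δ r c with r ≟ c | to c ≟ᴵ to r
      ... | yes _   | yes _    = refl
      ... | no _    | no _     = refl
      ... | yes r≡c | no tc≢tr  = ⊥-elim (tc≢tr (≡.cong to (≡.sym r≡c)))
      ... | no r≢c  | yes tc≡tr = ⊥-elim (r≢c (≡.sym (to-injective tc≡tr)))

-- The commutative ring ℤ[λ]

module Polynomials where
  open +-*-Solver using (solve; _:=_; _:+_; _:*_)
  open ≡.≡-Reasoning

  private
    scale : ℤ → Poly → Poly
    scale a = map (a ℤ.*_)

    shift : Poly → Poly
    shift p = 0ℤ ∷ p

  coeff-+ : ∀ p q n → coeff (p +ₚ q) n ≡ coeff p n ℤ.+ coeff q n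
  coeff-+ []      q       n       = ≡.sym (ℤ.+-identityˡ _)
  coeff-+ (a ∷ p) []      n       = ≡.sym (ℤ.+-identityʳ _)
  coeff-+ (a ∷ p) (b ∷ q) zero    = ≡.refl
  coeff-+ (a ∷ p) (b ∷ q) (suc n) = coeff-+ p q n

  coeff-neg : ∀ p n → coeff (negₚ p) n ≡ ℤ.- coeff p n
  coeff-neg []      n       = ≡.refl
  coeff-neg (a ∷ p) zero    = ≡.refl
  coeff-neg (a ∷ p) (suc n) = coeff-neg p n

  coeff-scale : ∀ a p n → coeff (scale a p) n ≡ a ℤ.* coeff p n
  coeff-scale a []      n       = ≡.sym (ℤ.*-zeroʳ a)
  coeff-scale a (b ∷ p) zero    = ≡.refl
  coeff-scale a (b ∷ p) (suc n) = coeff-scale a p n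

  -- The ring laws hold only up to trailing zeros, so the inductions run on coefficients. This
  -- recursion, with `shift` as multiplication by λ, stands for the definition of the product.
  coeff-∷* : ∀ a p q n → coeff ((a ∷ p) *ₚ q) n ≡ a ℤ.* coeff q n ℤ.+ coeff (shift (p *ₚ q)) n
  coeff-∷* a p q n = ≡.trans (coeff-+ (scale a q) (shift (p *ₚ q)) n) (≡.cong (ℤ._+ _) (coeff-scale a q n))

  shift-cong : ∀ {p q} → p ≈ₚ q → shift p ≈ₚ shift q
  shift-cong p≈q zero    = ≡.refl
  shift-cong p≈q (suc n) = p≈q n

  +ₚ-cong : ∀ {p p′ q q′} → p ≈ₚ p′ → q ≈ₚ q′ → p +ₚ q ≈ₚ p′ +ₚ q′
  +ₚ-cong {p} {p′} {q} {q′} p≈ q≈ n = begin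
    coeff (p +ₚ q) n            ≡⟨ coeff-+ p q n ⟩
    coeff p n ℤ.+ coeff q n     ≡⟨ ≡.cong₂ ℤ._+_ (p≈ n) (q≈ n) ⟩
    coeff p′ n ℤ.+ coeff q′ n   ≡⟨ coeff-+ p′ q′ n ⟨
    coeff (p′ +ₚ q′) n ∎

  *ₚ-congˡ : ∀ p {q q′} → q ≈ₚ q′ → p *ₚ q ≈ₚ p *ₚ q′
  *ₚ-congˡ []      q≈ n = ≡.refl
  *ₚ-congˡ (a ∷ p) {q} {q′} q≈ n = begin
    coeff ((a ∷ p) *ₚ q) n                            ≡⟨ coeff-∷* a p q n ⟩
    a ℤ.* coeff q n ℤ.+ coeff (shift (p *ₚ q)) n      ≡⟨ ≡.cong₂ (λ x y → a ℤ.* x ℤ.+ y) (q≈ n)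
                                                           (shift-cong {p *ₚ q} (*ₚ-congˡ p q≈) n) ⟩
    a ℤ.* coeff q′ n ℤ.+ coeff (shift (p *ₚ q′)) n    ≡⟨ coeff-∷* a p q′ n ⟨
    coeff ((a ∷ p) *ₚ q′) n ∎

  -- The mirror image of `coeff-∷*`, in the second factor; the two together make commutativity an
  -- induction on the first factor.
  *ₚ-∷ : ∀ p b q n → coeff (p *ₚ (b ∷ q)) n ≡ b ℤ.* coeff p n ℤ.+ coeff (shift (p *ₚ q)) n
  *ₚ-∷ []      b q zero    = ≡.sym (≡.trans (ℤ.+-identityʳ _) (ℤ.*-zeroʳ b))
  *ₚ-∷ []      b q (suc n) = ≡.sym (≡.trans (ℤ.+-identityʳ _) (ℤ.*-zeroʳ b))
  *ₚ-∷ (a ∷ p) b q zero    = ≡.cong (ℤ._+ 0ℤ) (ℤ.*-comm a b)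
  *ₚ-∷ (a ∷ p) b q (suc n) = begin
    coeff (scale a q +ₚ p *ₚ (b ∷ q)) n
      ≡⟨ coeff-+ (scale a q) _ n ⟩
    coeff (scale a q) n ℤ.+ coeff (p *ₚ (b ∷ q)) n
      ≡⟨ ≡.cong₂ ℤ._+_ (coeff-scale a q n) (*ₚ-∷ p b q n) ⟩
    a ℤ.* coeff q n ℤ.+ (b ℤ.* coeff p n ℤ.+ coeff (shift (p *ₚ q)) n)
      ≡⟨ solve 3 (λ x y z → x :+ (y :+ z) := y :+ (x :+ z)) ≡.refl (a ℤ.* coeff q n) (b ℤ.* coeff p n) _ ⟩
    b ℤ.* coeff p n ℤ.+ (a ℤ.* coeff q n ℤ.+ coeff (shift (p *ₚ q)) n)
      ≡⟨ ≡.cong (λ z → b ℤ.* coeff p n ℤ.+ z) (coeff-∷* a p q n) ⟨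
    b ℤ.* coeff p n ℤ.+ coeff ((a ∷ p) *ₚ q) n ∎

  *ₚ-comm : ∀ p q → p *ₚ q ≈ₚ q *ₚ p
  *ₚ-comm []      []      n = ≡.refl
  *ₚ-comm []      (b ∷ q) zero    = ≡.refl
  *ₚ-comm []      (b ∷ q) (suc n) = *ₚ-comm [] q n
  *ₚ-comm (a ∷ p) q n = begin
    coeff ((a ∷ p) *ₚ q) n                           ≡⟨ coeff-∷* a p q n ⟩
    a ℤ.* coeff q n ℤ.+ coeff (shift (p *ₚ q)) n     ≡⟨ ≡.cong (λ z → a ℤ.* coeff q n ℤ.+ z)
                                                          (shift-cong {p *ₚ q} (*ₚ-comm p q) n) ⟩
    a ℤ.* coeff q n ℤ.+ coeff (shift (q *ₚ p)) n     ≡⟨ *ₚ-∷ q a p n ⟨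
    coeff (q *ₚ (a ∷ p)) n ∎

  *ₚ-distribʳ-+ₚ : ∀ r p q → (p +ₚ q) *ₚ r ≈ₚ p *ₚ r +ₚ q *ₚ r
  *ₚ-distribʳ-+ₚ r []      q       n = ≡.refl
  *ₚ-distribʳ-+ₚ r (a ∷ p) []      n = ≡.sym (≡.trans (coeff-+ ((a ∷ p) *ₚ r) [] n) (ℤ.+-identityʳ _))
  *ₚ-distribʳ-+ₚ r (a ∷ p) (b ∷ q) n = begin
    coeff ((a ℤ.+ b ∷ p +ₚ q) *ₚ r) n
      ≡⟨ coeff-∷* (a ℤ.+ b) (p +ₚ q) r n ⟩
    (a ℤ.+ b) ℤ.* coeff r n ℤ.+ coeff (shift ((p +ₚ q) *ₚ r)) n
      ≡⟨ ≡.cong (λ z → (a ℤ.+ b) ℤ.* coeff r n ℤ.+ z)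
           (≡.trans (shift-cong {(p +ₚ q) *ₚ r} (*ₚ-distribʳ-+ₚ r p q) n)
                    (coeff-+ (shift (p *ₚ r)) (shift (q *ₚ r)) n)) ⟩
    (a ℤ.+ b) ℤ.* coeff r n ℤ.+ (coeff (shift (p *ₚ r)) n ℤ.+ coeff (shift (q *ₚ r)) n)
      ≡⟨ solve 5 (λ a b x y z → (a :+ b) :* x :+ (y :+ z) := (a :* x :+ y) :+ (b :* x :+ z))
           ≡.refl a b (coeff r n) _ _ ⟩
    (a ℤ.* coeff r n ℤ.+ coeff (shift (p *ₚ r)) n) ℤ.+ (b ℤ.* coeff r n ℤ.+ coeff (shift (q *ₚ r)) n)
      ≡⟨ ≡.cong₂ ℤ._+_ (coeff-∷* a p r n) (coeff-∷* b q r n) ⟨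
    coeff ((a ∷ p) *ₚ r) n ℤ.+ coeff ((b ∷ q) *ₚ r) n
      ≡⟨ coeff-+ ((a ∷ p) *ₚ r) ((b ∷ q) *ₚ r) n ⟨
    coeff ((a ∷ p) *ₚ r +ₚ (b ∷ q) *ₚ r) n ∎

  scale-*ₚ : ∀ a p q n → coeff (scale a p *ₚ q) n ≡ a ℤ.* coeff (p *ₚ q) n
  scale-*ₚ a []      q n = ≡.sym (ℤ.*-zeroʳ a)
  scale-*ₚ a (b ∷ p) q n = begin
    coeff ((a ℤ.* b ∷ scale a p) *ₚ q) n
      ≡⟨ coeff-∷* (a ℤ.* b) (scale a p) q n ⟩
    a ℤ.* b ℤ.* coeff q n ℤ.+ coeff (shift (scale a p *ₚ q)) n
      ≡⟨ ≡.cong (λ z → a ℤ.* b ℤ.* coeff q n ℤ.+ z) (shifted n) ⟩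
    a ℤ.* b ℤ.* coeff q n ℤ.+ a ℤ.* coeff (shift (p *ₚ q)) n
      ≡⟨ solve 4 (λ a b x y → a :* b :* x :+ a :* y := a :* (b :* x :+ y)) ≡.refl a b (coeff q n) _ ⟩
    a ℤ.* (b ℤ.* coeff q n ℤ.+ coeff (shift (p *ₚ q)) n)
      ≡⟨ ≡.cong (a ℤ.*_) (coeff-∷* b p q n) ⟨
    a ℤ.* coeff ((b ∷ p) *ₚ q) n ∎
    where
    shifted : ∀ n → coeff (shift (scale a p *ₚ q)) n ≡ a ℤ.* coeff (shift (p *ₚ q)) n
    shifted zero    = ≡.sym (ℤ.*-zeroʳ a)
    shifted (suc n) = scale-*ₚ a p q n

  *ₚ-assoc : ∀ p q r → (p *ₚ q) *ₚ r ≈ₚ p *ₚ (q *ₚ r)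
  *ₚ-assoc []      q r n = ≡.refl
  *ₚ-assoc (a ∷ p) q r n = begin
    coeff ((scale a q +ₚ shift (p *ₚ q)) *ₚ r) n
      ≡⟨ *ₚ-distribʳ-+ₚ r (scale a q) (shift (p *ₚ q)) n ⟩
    coeff (scale a q *ₚ r +ₚ shift (p *ₚ q) *ₚ r) n
      ≡⟨ coeff-+ (scale a q *ₚ r) _ n ⟩
    coeff (scale a q *ₚ r) n ℤ.+ coeff (shift (p *ₚ q) *ₚ r) n
      ≡⟨ ≡.cong₂ ℤ._+_ (scale-*ₚ a q r n) (≡.trans (coeff-∷* 0ℤ (p *ₚ q) r n) (ℤ.+-identityˡ _)) ⟩
    a ℤ.* coeff (q *ₚ r) n ℤ.+ coeff (shift ((p *ₚ q) *ₚ r)) n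
      ≡⟨ ≡.cong (λ z → a ℤ.* coeff (q *ₚ r) n ℤ.+ z) (shift-cong {(p *ₚ q) *ₚ r} (*ₚ-assoc p q r) n) ⟩
    a ℤ.* coeff (q *ₚ r) n ℤ.+ coeff (shift (p *ₚ (q *ₚ r))) n
      ≡⟨ coeff-∷* a p (q *ₚ r) n ⟨
    coeff ((a ∷ p) *ₚ (q *ₚ r)) n ∎

  *ₚ-cong : ∀ {p p′ q q′} → p ≈ₚ p′ → q ≈ₚ q′ → p *ₚ q ≈ₚ p′ *ₚ q′
  *ₚ-cong {p} {p′} {q} {q′} p≈ q≈ n = begin
    coeff (p *ₚ q) n     ≡⟨ *ₚ-congˡ p q≈ n ⟩
    coeff (p *ₚ q′) n    ≡⟨ *ₚ-comm p q′ n ⟩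
    coeff (q′ *ₚ p) n    ≡⟨ *ₚ-congˡ q′ p≈ n ⟩
    coeff (q′ *ₚ p′) n   ≡⟨ *ₚ-comm q′ p′ n ⟩
    coeff (p′ *ₚ q′) n ∎

  *ₚ-identityˡ : ∀ p → C 1ℤ *ₚ p ≈ₚ p
  *ₚ-identityˡ p n = begin
    coeff (C 1ℤ *ₚ p) n                          ≡⟨ coeff-∷* 1ℤ [] p n ⟩
    1ℤ ℤ.* coeff p n ℤ.+ coeff (shift []) n      ≡⟨ ≡.cong₂ ℤ._+_ (ℤ.*-identityˡ (coeff p n)) (shift[] n) ⟩
    coeff p n ℤ.+ 0ℤ                             ≡⟨ ℤ.+-identityʳ _ ⟩
    coeff p n ∎
    where
    shift[] : shift [] ≈ₚ []
    shift[] zero    = ≡.refl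
    shift[] (suc n) = ≡.refl

  +ₚ-assoc : ∀ p q r → (p +ₚ q) +ₚ r ≈ₚ p +ₚ (q +ₚ r)
  +ₚ-assoc p q r n = begin
    coeff ((p +ₚ q) +ₚ r) n                       ≡⟨ coeff-+ (p +ₚ q) r n ⟩
    coeff (p +ₚ q) n ℤ.+ coeff r n                ≡⟨ ≡.cong (ℤ._+ coeff r n) (coeff-+ p q n) ⟩
    coeff p n ℤ.+ coeff q n ℤ.+ coeff r n         ≡⟨ ℤ.+-assoc (coeff p n) (coeff q n) (coeff r n) ⟩
    coeff p n ℤ.+ (coeff q n ℤ.+ coeff r n)       ≡⟨ ≡.cong (λ z → coeff p n ℤ.+ z) (coeff-+ q r n) ⟨
    coeff p n ℤ.+ coeff (q +ₚ r) n                ≡⟨ coeff-+ p (q +ₚ r) n ⟨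
    coeff (p +ₚ (q +ₚ r)) n ∎

  +ₚ-comm : ∀ p q → p +ₚ q ≈ₚ q +ₚ p
  +ₚ-comm p q n = begin
    coeff (p +ₚ q) n          ≡⟨ coeff-+ p q n ⟩
    coeff p n ℤ.+ coeff q n   ≡⟨ ℤ.+-comm (coeff p n) (coeff q n) ⟩
    coeff q n ℤ.+ coeff p n   ≡⟨ coeff-+ q p n ⟨
    coeff (q +ₚ p) n ∎

  negₚ-inverseʳ : ∀ p → p +ₚ negₚ p ≈ₚ []
  negₚ-inverseʳ p n = begin
    coeff (p +ₚ negₚ p) n            ≡⟨ coeff-+ p (negₚ p) n ⟩
    coeff p n ℤ.+ coeff (negₚ p) n   ≡⟨ ≡.cong (λ z → coeff p n ℤ.+ z) (coeff-neg p n) ⟩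
    coeff p n ℤ.- coeff p n          ≡⟨ ℤ.+-inverseʳ (coeff p n) ⟩
    0ℤ ∎

  negₚ-cong : ∀ {p q} → p ≈ₚ q → negₚ p ≈ₚ negₚ q
  negₚ-cong {p} {q} p≈q n =
    ≡.trans (coeff-neg p n) (≡.trans (≡.cong ℤ.-_ (p≈q n)) (≡.sym (coeff-neg q n)))

  ≈ₚ-trans : ∀ {p q r} → p ≈ₚ q → q ≈ₚ r → p ≈ₚ r
  ≈ₚ-trans p≈q q≈r n = ≡.trans (p≈q n) (q≈r n)

  ℤ[X]-isCommutativeRing : IsCommutativeRing _≈ₚ_ _+ₚ_ _*ₚ_ negₚ [] (C 1ℤ)
  ℤ[X]-isCommutativeRing = record
    { isRing = record
      { +-isAbelianGroup = record
        { isGroup = record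
          { isMonoid = record
            { isSemigroup = record
              { isMagma = record
                { isEquivalence = record
                  { refl  = λ n → ≡.refl
                  ; sym   = λ p≈q n → ≡.sym (p≈q n)
                  ; trans = λ {p} {q} {r} → ≈ₚ-trans {p} {q} {r}
                  }
                ; ∙-cong = λ {p} {p′} {q} {q′} → +ₚ-cong {p} {p′} {q} {q′}
                }
              ; assoc = +ₚ-assoc
              }
            ; identity = (λ p n → ≡.refl) , λ p → +ₚ-comm p []
            }
          ; inverse =
              (λ p → ≈ₚ-trans {negₚ p +ₚ p} {p +ₚ negₚ p} {[]} (+ₚ-comm (negₚ p) p) (negₚ-inverseʳ p))
              , negₚ-inverseʳ
          ; ⁻¹-cong = λ {p} {q} → negₚ-cong {p} {q}
          }
        ; comm = +ₚ-comm
        }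
      ; *-cong = λ {p} {p′} {q} {q′} → *ₚ-cong {p} {p′} {q} {q′}
      ; *-assoc = *ₚ-assoc
      ; *-identity = *ₚ-identityˡ ,
          λ p → ≈ₚ-trans {p *ₚ C 1ℤ} {C 1ℤ *ₚ p} {p} (*ₚ-comm p (C 1ℤ)) (*ₚ-identityˡ p)
      ; distrib =
          (λ p q r → ≈ₚ-trans {p *ₚ (q +ₚ r)} {(q +ₚ r) *ₚ p} {p *ₚ q +ₚ p *ₚ r} (*ₚ-comm p (q +ₚ r))
            (≈ₚ-trans {(q +ₚ r) *ₚ p} {q *ₚ p +ₚ r *ₚ p} {p *ₚ q +ₚ p *ₚ r} (*ₚ-distribʳ-+ₚ p q r)
              (+ₚ-cong {q *ₚ p} {p *ₚ q} {r *ₚ p} {p *ₚ r} (*ₚ-comm q p) (*ₚ-comm r p))))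
          , *ₚ-distribʳ-+ₚ
      }
    ; *-comm = *ₚ-comm
    }

  ℤ[X]-commutativeRing : CommutativeRing 0ℓ 0ℓ
  ℤ[X]-commutativeRing = record { isCommutativeRing = ℤ[X]-isCommutativeRing }

  C-homo : AlmostCommutativeRing.rawRing (fromCommutativeRing ℤ.+-*-commutativeRing)
           -Raw-AlmostCommutative⟶ fromCommutativeRing ℤ[X]-commutativeRing
  C-homo = record
    { ⟦_⟧    = C
    ; +-homo = λ a b n → ≡.refl
    ; *-homo = λ { a b zero → ≡.sym (ℤ.+-identityʳ _) ; a b (suc n) → ≡.refl }
    ; -‿homo = λ a n → ≡.refl
    ; 0-homo = λ { zero → ≡.refl ; (suc n) → ≡.refl }
    ; 1-homo = λ n → ≡.refl
    }

-- Column operations on the sunflower matrix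

Vertex : ℕ → ℕ → Set
Vertex m n = Maybe (Fin m × Fin n)

-- center is v₀₀ and ⟨ i , j ⟩ is v k i j; the core vertices are center and ⟨ i , 0F ⟩.
pattern center = nothing
pattern ⟨_,_⟩ i j = just (i , j)
pattern 2+_ j = suc (suc j)

-- The solver needs coefficients whose equality can be tested, hence integers. The map is a
-- parameter so that for polynomials it is `C`, in terms of which the result is stated.
ℤ-algebra : ∀ {a ℓ} → CommutativeRing a ℓ → Set _
ℤ-algebra R = AlmostCommutativeRing.rawRing (fromCommutativeRing ℤ.+-*-commutativeRing)
              -Raw-AlmostCommutative⟶ fromCommutativeRing R

module ℤ-AlgebraSolver {a ℓ} (R : CommutativeRing a ℓ) (ι-homo : ℤ-algebra R) where
  open CommutativeRing R
  open _-Raw-AlmostCommutative⟶_ ι-homo renaming (⟦_⟧ to ι)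

  coefficient-≟ : ∀ b c → Maybe (ι b ≈ ι c)
  coefficient-≟ b c = Maybe.map (reflexive ∘ ≡.cong ι) (dec⇒weaklyDec ℤ._≟_ b c)

  open RingSolver _ (fromCommutativeRing R) ι-homo coefficient-≟ public

-- There are m + 1 petals with p + 2 vertices each.
module SunflowerColumns {a ℓ} (R : CommutativeRing a ℓ) (ι-homo : ℤ-algebra R)
  (m p : ℕ) {J : Set} (e : Vertex (suc m) (suc (suc p)) → J → CommutativeRing.Carrier R)
  (x : CommutativeRing.Carrier R)
  where
  open CommutativeRing R hiding (zero)
  open Sum semiring
  open SetoidReasoning setoid
  open _-Raw-AlmostCommutative⟶_ ι-homo renaming (⟦_⟧ to ι)

  open ℤ-AlgebraSolver R ι-homo
    using (solve; _:=_; _:+_; _:*_; _:-_; :-_; con)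

  private
    V = Vertex (suc m) (suc (suc p))
    Columns = V → J → Carrier

    ι1≈1 : ι 1ℤ ≈ 1#
    ι1≈1 = 1-homo

  sum-constant : ∀ n y → sum {n} (λ _ → y) ≈ ι (+ n) * y
  sum-constant ℕ.zero  y = sym (trans (*-congʳ 0-homo) (zeroˡ y))
  sum-constant (suc n) y = begin
    y + sum {n} (λ _ → y)      ≈⟨ +-cong (sym (trans (*-congʳ ι1≈1) (*-identityˡ y))) (sum-constant n y) ⟩
    ι 1ℤ * y + ι (+ n) * y     ≈⟨ distribʳ y (ι 1ℤ) (ι (+ n)) ⟨
    (ι 1ℤ + ι (+ n)) * y       ≈⟨ *-congʳ (+-homo 1ℤ (+ n)) ⟨
    ι (+ suc n) * y ∎

  sum-+-constant : ∀ {n} (u : Fin n → Carrier) y → sum (λ i → u i + y) ≈ sum u + ι (+ n) * y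
  sum-+-constant {n} u y = trans (∑-distrib-+ u (λ _ → y)) (+-congˡ (sum-constant n y))

  -- A petal has `K + ι 1ℤ` outer vertices, and `g` is the eigenvalue of J - tI on them for the
  -- all-ones vector. Summing the outer vertices of the block J - tI - E₁₁ leaves the 2×2 quotient
  -- with rows (-t , K + 1) and (1 , g), whose determinant is `q`.
  M K t g q : Carrier
  M = ι (+ m)
  K = ι (+ p)
  t = x + ι 1ℤ
  g = K + ι 1ℤ - t
  q = - (t * g + (K + ι 1ℤ))

  tails : Fin (suc m) → J → Carrier
  tails i r = sum (λ j → e ⟨ i , 2+ j ⟩ r)

  -- A₁₂ is A - xI when e is the identity matrix.  Each family arises from the
  -- previous one by adding to the redefined columns multiples of unchanged ones,
  -- except that A₆ mixes two columns, A₈ scales m columns by q and A₁₁ scales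
  -- (m + 1) p columns by - t.  In A₄ and A₃ the two columns of a petal are the image
  -- of its two basis columns under a matrix of determinant 1 whose second column
  -- is (1 , g), the remainder of a petal block after clearing its outer rows.
  A₁ A₂ A₃ A₄ A₅ A₆ A₇ A₈ A₉ A₁₀ A₁₁ A₁₂ : Columns

  A₁ ⟨ i , 2+ j ⟩ r = e ⟨ i , 2+ j ⟩ r - e ⟨ i , 1F ⟩ r
  A₁ c            r = e c r

  A₂ ⟨ i , 0F ⟩ r = e ⟨ i , 0F ⟩ r + (g - ι 1ℤ) * e ⟨ i , 1F ⟩ r
  A₂ c          r = A₁ c r

  A₃ ⟨ i , 1F ⟩ r = e ⟨ i , 0F ⟩ r + g * e ⟨ i , 1F ⟩ r
  A₃ c          r = A₂ c r

  A₄ ⟨ i , 0F ⟩ r = - e ⟨ i , 1F ⟩ r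
  A₄ c          r = A₃ c r

  A₅ ⟨ i , suc j ⟩    r = A₄ ⟨ i , suc j ⟩ r
  A₅ ⟨ suc i , 0F ⟩ r = e ⟨ 0F , 1F ⟩ r - e ⟨ suc i , 1F ⟩ r
  A₅ c                r = A₄ c r

  A₆ center        r = - x * e center r - (M + ι 1ℤ) * g * e ⟨ 0F , 1F ⟩ r
  A₆ ⟨ i , suc j ⟩ r = A₅ ⟨ i , suc j ⟩ r
  A₆ ⟨ 0F , 0F ⟩   r = t * e center r - q * e ⟨ 0F , 1F ⟩ r
  A₆ c             r = A₅ c r

  A₇ center r = - x * e center r + sum (λ i → e ⟨ i , 0F ⟩ r)
  A₇ c      r = A₆ c r

  A₈ ⟨ i , 0F ⟩ r = t * e center r - q * e ⟨ i , 1F ⟩ r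
  A₈ c          r = A₇ c r

  A₉ ⟨ i , 0F ⟩ r = t * e center r - t * e ⟨ i , 0F ⟩ r + e ⟨ i , 1F ⟩ r + tails i r
  A₉ c          r = A₈ c r

  A₁₀ ⟨ i , 1F ⟩ r = e ⟨ i , 0F ⟩ r + e ⟨ i , 1F ⟩ r + tails i r - t * e ⟨ i , 1F ⟩ r
  A₁₀ c          r = A₉ c r

  A₁₁ ⟨ i , 2+ j ⟩ r = e ⟨ i , 0F ⟩ r + e ⟨ i , 1F ⟩ r + tails i r - t * e ⟨ i , 2+ j ⟩ r
  A₁₁ c            r = A₁₀ c r

  A₁₂ ⟨ i , 0F ⟩ r = e center r + sum (λ i → e ⟨ i , 0F ⟩ r) + e ⟨ i , 1F ⟩ r + tails i r - t * e ⟨ i , 0F ⟩ r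
  A₁₂ c          r = A₁₁ c r

  A₁₂-center : ∀ r → A₁₂ center r ≈ e center r + sum (λ i → e ⟨ i , 0F ⟩ r) - t * e center r
  A₁₂-center r = solve 3 (λ x c S → :- x :* c :+ S := (c :+ S) :- (x :+ con 1ℤ) :* c)
    refl x (e center r) (sum (λ i → e ⟨ i , 0F ⟩ r))

  A₁₂-inner : ∀ i r → A₁₂ ⟨ i , 0F ⟩ r ≈
    (e center r + sum (λ i → e ⟨ i , 0F ⟩ r)) + sum (λ j → e ⟨ i , j ⟩ r) - (ι 1ℤ + t) * e ⟨ i , 0F ⟩ r
  A₁₂-inner i r = solve 6
    (λ c S a b T t → c :+ S :+ b :+ T :- t :* a := (c :+ S) :+ (a :+ (b :+ T)) :- (con 1ℤ :+ t) :* a)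
    refl (e center r) (sum (λ i → e ⟨ i , 0F ⟩ r)) (e ⟨ i , 0F ⟩ r) (e ⟨ i , 1F ⟩ r) (tails i r) t

  A₁₂-outer : ∀ i j r → A₁₂ ⟨ i , suc j ⟩ r ≈ sum (λ j → e ⟨ i , j ⟩ r) - t * e ⟨ i , suc j ⟩ r
  A₁₂-outer i zero    r = +-congʳ (+-assoc (e ⟨ i , 0F ⟩ r) (e ⟨ i , 1F ⟩ r) (tails i r))
  A₁₂-outer i (suc j) r = +-congʳ (+-assoc (e ⟨ i , 0F ⟩ r) (e ⟨ i , 1F ⟩ r) (tails i r))

-- Effect of the column operations on the form

module SunflowerReduction {a ℓ} (R : CommutativeRing a ℓ) (ι-homo : ℤ-algebra R)
  (m p : ℕ) {J : Set} (e : Vertex (suc m) (suc (suc p)) → J → CommutativeRing.Carrier R)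
  (x : CommutativeRing.Carrier R)
  (Φ : MultilinearForms.MultilinearForm R (Vertex (suc m) (suc (suc p))) J)
  (alternating : ∀ {c d} → c ≢ d → MultilinearForms.MultilinearForm.AlternatingAt Φ c d)
  where
  open CommutativeRing R hiding (zero)
  open Sum semiring
  open Exp semiring using (_^_)
  open SetoidReasoning setoid
  open MultilinearForms R
  open MultilinearForm Φ
  open _-Raw-AlmostCommutative⟶_ ι-homo renaming (⟦_⟧ to ι; 1-homo to ι1≈1)
  open SunflowerColumns R ι-homo m p e x

  open ℤ-AlgebraSolver R ι-homo
    using (solve; _:=_; _:+_; _:*_; _:-_; :-_; con)

  private
    V = Vertex (suc m) (suc (suc p))

  private
    outer : Fin (suc m ℕ.* p) → V
    outer y = ⟨ proj₁ (remQuot {suc m} p y) , 2+ proj₂ (remQuot {suc m} p y) ⟩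

    outer-injective : ∀ {y z} → outer y ≡ outer z → y ≡ z
    outer-injective {y} {z} eq = ≡.trans (≡.sym (combine-remQuot {suc m} p y))
      (≡.trans (≡.cong (uncurry combine) (unwrap eq)) (combine-remQuot {suc m} p z))
      where
      unwrap : ∀ {i i′ j j′} → _≡_ {A = V} ⟨ i , 2+ j ⟩ ⟨ i′ , 2+ j′ ⟩ → (i , j) ≡ (i′ , j′)
      unwrap ≡.refl = ≡.refl

    outer-combine : ∀ i j → ⟨ i , 2+ j ⟩ ≡ outer (combine i j)
    outer-combine i j = ≡.cong (λ (i , j) → ⟨ i , 2+ j ⟩) (≡.sym (remQuot-combine {suc m} i j))

  private
    1^n≈1 : ∀ n → ι 1ℤ ^ n ≈ 1#
    1^n≈1 ℕ.zero  = refl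
    1^n≈1 (suc n) = trans (*-cong ι1≈1 (1^n≈1 n)) (*-identityˡ 1#)

    -- The coefficient is `ι 1ℤ` and not `1#` because this is how the solver interprets `con 1ℤ`.
    adjust-columns : ∀ n (h : Fin n → V) → (∀ {y z} → h y ≡ h z → y ≡ z) → ∀ F G →
                     (∀ y → _≈_·_+Span_ alternating (G (h y)) (ι 1ℤ) (F (h y))
                              (Span alternating F (λ d → ∀ z → d ≢ h z))) →
                     (∀ d → (∀ y → d ≢ h y) → G d ≋ F d) →
                     form G ≈ form F
    adjust-columns n h inj F G Gh G≋F = trans
      (replace-columns alternating n h inj {F} {G} (ι 1ℤ) Gh G≋F)
      (trans (*-congʳ (1^n≈1 n)) (*-identityˡ _))

    inner : ∀ j → Fin (suc m) → V
    inner j i = ⟨ i , j ⟩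

    inner-injective : ∀ {j i i′} → inner j i ≡ inner j i′ → i ≡ i′
    inner-injective ≡.refl = ≡.refl

    tails-A₁ : ∀ i r → sum (λ j → A₁ ⟨ i , 2+ j ⟩ r) ≈ tails i r + K * (- e ⟨ i , 1F ⟩ r)
    tails-A₁ i r = sum-+-constant (λ j → e ⟨ i , 2+ j ⟩ r) (- e ⟨ i , 1F ⟩ r)

    step₁ : form A₁ ≈ form e
    step₁ = adjust-columns (suc m ℕ.* p) outer outer-injective e A₁
      (λ y → by (scale (- ι 1ℤ) (column {d = ⟨ proj₁ (remQuot {suc m} p y) , 1F ⟩} λ _ ()))
        λ r → solve 2 (λ a b → a :- b := con 1ℤ :* a :+ :- con 1ℤ :* b) refl _ _)
      λ { center ≢ r → refl ; ⟨ i , 0F ⟩ ≢ r → refl ; ⟨ i , 1F ⟩ ≢ r → refl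
        ; ⟨ i , 2+ j ⟩ ≢ r → ⊥-elim (≢ _ (outer-combine i j)) }

    -- With a and b for the two basis columns of a petal, the passage from (a , b) to (-b , a + g b)
    -- is split over `step₂` to `step₄` into three shears: add (g - 1) b to the first, the first to
    -- the second, and subtract the second from the first.
    step₂ : form A₂ ≈ form A₁
    step₂ = adjust-columns (suc m) (inner 0F) inner-injective A₁ A₂
      (λ i → by (scale (g - ι 1ℤ) (column {d = ⟨ i , 1F ⟩} λ _ ()))
        λ r → solve 2 (λ a b → a :+ b := con 1ℤ :* a :+ b) refl _ _)
      λ { center ≢ r → refl ; ⟨ i , 0F ⟩ ≢ r → ⊥-elim (≢ i ≡.refl)
        ; ⟨ i , 1F ⟩ ≢ r → refl ; ⟨ i , 2+ j ⟩ ≢ r → refl }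

    step₃ : form A₃ ≈ form A₂
    step₃ = adjust-columns (suc m) (inner 1F) inner-injective A₂ A₃
      (λ i → by (column {d = ⟨ i , 0F ⟩} λ _ ())
        λ r → solve 3 (λ a b g → a :+ g :* b := con 1ℤ :* b :+ (a :+ (g :- con 1ℤ) :* b)) refl _ _ g)
      λ { center ≢ r → refl ; ⟨ i , 0F ⟩ ≢ r → refl
        ; ⟨ i , 1F ⟩ ≢ r → ⊥-elim (≢ i ≡.refl) ; ⟨ i , 2+ j ⟩ ≢ r → refl }

    step₄ : form A₄ ≈ form A₃
    step₄ = adjust-columns (suc m) (inner 0F) inner-injective A₃ A₄
      (λ i → by (scale (- ι 1ℤ) (column {d = ⟨ i , 1F ⟩} λ _ ()))
        λ r → solve 3 (λ a b g → :- b := con 1ℤ :* (a :+ (g :- con 1ℤ) :* b) :+ :- con 1ℤ :* (a :+ g :* b))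
          refl (e ⟨ i , 0F ⟩ r) _ g)
      λ { center ≢ r → refl ; ⟨ i , 0F ⟩ ≢ r → ⊥-elim (≢ i ≡.refl)
        ; ⟨ i , 1F ⟩ ≢ r → refl ; ⟨ i , 2+ j ⟩ ≢ r → refl }

    -- Prepares the differences of the vectors `e ⟨ i , 1F ⟩`: in `A₈` the core columns of two
    -- petals differ by `q` times such a difference.
    step₅ : form A₅ ≈ form A₄
    step₅ = adjust-columns m (inner 0F ∘ suc) (suc-injective ∘ inner-injective) A₄ A₅
      (λ i → by (scale (- ι 1ℤ) (column {d = ⟨ 0F , 0F ⟩} λ _ ()))
        λ r → solve 2 (λ a b → a :- b := con 1ℤ :* (:- b) :+ :- con 1ℤ :* (:- a)) refl _ _)
      λ { center ≢ r → refl ; ⟨ 0F , 0F ⟩ ≢ r → refl ; ⟨ suc i , 0F ⟩ ≢ r → ⊥-elim (≢ i ≡.refl)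
        ; ⟨ 0F , 1F ⟩ ≢ r → refl ; ⟨ suc i , 1F ⟩ ≢ r → refl
        ; ⟨ 0F , 2+ j ⟩ ≢ r → refl ; ⟨ suc i , 2+ j ⟩ ≢ r → refl }

    -- Write aᵢ and bᵢ for `e ⟨ i , 0F ⟩` and `e ⟨ i , 1F ⟩`. Modulo the columns aᵢ + g bᵢ and b₀ -
    -- bᵢ, each aᵢ equals -g b₀, so the sum of the aᵢ in the column of v₀₀ becomes -(M + 1) g b₀.
    -- This is the origin of the coefficient `(M + ι 1ℤ) * g`.
    step₆ : form A₆ ≈ (- x * q - (M + ι 1ℤ) * g * t) * form A₅
    step₆ = mix-columns {center} {⟨ 0F , 0F ⟩} (λ ()) (alternating λ ()) A₅ {A₆} (- x) ((M + ι 1ℤ) * g) t q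
      (λ { center ≢ _ r → ⊥-elim (≢ ≡.refl) ; ⟨ 0F , 0F ⟩ _ ≢ r → ⊥-elim (≢ ≡.refl)
         ; ⟨ suc i , 0F ⟩ _ _ r → refl ; ⟨ 0F , 1F ⟩ _ _ r → refl ; ⟨ suc i , 1F ⟩ _ _ r → refl
         ; ⟨ 0F , 2+ j ⟩ _ _ r → refl ; ⟨ suc i , 2+ j ⟩ _ _ r → refl })
      (λ r → solve 4 (λ a b c d → a :* c :- b :* d := a :* c :+ b :* (:- d)) refl (- x) _ _ _)
      (λ r → solve 4 (λ a b c d → a :* c :- b :* d := a :* c :+ b :* (:- d)) refl t q _ _)

    step₇ : form A₇ ≈ form A₆
    step₇ = trans
      (replace-column alternating {A₆} {A₇} center (ι 1ℤ)
        -- Petal 0 contributes its column a₀ + g b₀ alone; every other petal also needs g (b₀ - bᵢ)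
        -- to turn g bᵢ into g b₀.
        (add (column {d = ⟨ 0F , 1F ⟩} λ ()) (Span-sum alternating {us = spokes} λ i →
          add (scale g (column {d = ⟨ suc i , 0F ⟩} λ ())) (column {d = ⟨ suc i , 1F ⟩} λ ())))
        (λ { center ≢ r → ⊥-elim (≢ ≡.refl) ; ⟨ _ , _ ⟩ ≢ r → refl })
        equation)
      (trans (*-congʳ ι1≈1) (*-identityˡ _))
      where
      spokes : Fin m → J → Carrier
      spokes i r = g * A₆ ⟨ suc i , 0F ⟩ r + A₆ ⟨ suc i , 1F ⟩ r
      equation : ∀ r → A₇ center r ≈ ι 1ℤ * A₆ center r + (A₆ ⟨ 0F , 1F ⟩ r + sum (λ i → spokes i r))
      equation r = begin
        - x * e center r + (e ⟨ 0F , 0F ⟩ r + S)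
          ≈⟨ solve 7 (λ x c a b g M S → :- x :* c :+ (a :+ S) :=
               con 1ℤ :* (:- x :* c :- (M :+ con 1ℤ) :* g :* b) :+ ((a :+ g :* b) :+ (S :+ M :* (g :* b))))
               refl x (e center r) (e ⟨ 0F , 0F ⟩ r) (e ⟨ 0F , 1F ⟩ r) g M S ⟩
        ι 1ℤ * A₆ center r + (A₆ ⟨ 0F , 1F ⟩ r + (S + M * (g * e ⟨ 0F , 1F ⟩ r)))
          ≈⟨ +-congˡ (+-congˡ (sum-+-constant (λ i → e ⟨ suc i , 0F ⟩ r) (g * e ⟨ 0F , 1F ⟩ r))) ⟨
        ι 1ℤ * A₆ center r + (A₆ ⟨ 0F , 1F ⟩ r + sum (λ i → e ⟨ suc i , 0F ⟩ r + g * e ⟨ 0F , 1F ⟩ r))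
          ≈⟨ +-congˡ (+-congˡ (sum-cong-≋ λ i →
               solve 4 (λ a b c g → a :+ g :* b := g :* (b :- c) :+ (a :+ g :* c))
               refl (e ⟨ suc i , 0F ⟩ r) (e ⟨ 0F , 1F ⟩ r) (e ⟨ suc i , 1F ⟩ r) g)) ⟩
        ι 1ℤ * A₆ center r + (A₆ ⟨ 0F , 1F ⟩ r + sum (λ i → spokes i r)) ∎
        where S = sum (λ i → e ⟨ suc i , 0F ⟩ r)

    -- Only the petals other than the first contribute a factor `q` here; the `q` of the first is
    -- already inside the 2×2 determinant of `step₆`.
    step₈ : form A₈ ≈ q ^ m * form A₇
    step₈ = replace-columns alternating m (inner 0F ∘ suc) (suc-injective ∘ inner-injective) {A₇} {A₈} q
      (λ i → by (column {d = ⟨ 0F , 0F ⟩} λ _ ())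
        λ r → solve 4 (λ a b c q → a :- q :* c := q :* (b :- c) :+ (a :- q :* b))
          refl _ (e ⟨ 0F , 1F ⟩ r) _ q)
      λ { center ≢ r → refl ; ⟨ 0F , 0F ⟩ ≢ r → refl ; ⟨ suc i , 0F ⟩ ≢ r → ⊥-elim (≢ i ≡.refl)
        ; ⟨ i , 1F ⟩ ≢ r → refl ; ⟨ i , 2+ j ⟩ ≢ r → refl }

    -- The value of `q` is fixed here: `e ⟨ i , 1F ⟩` must end with coefficient 1, and -q - t g - K
    -- = 1.
    step₉ : form A₉ ≈ form A₈
    step₉ = adjust-columns (suc m) (inner 0F) inner-injective A₈ A₉
      (λ i → by (add (scale (- t) (column {d = ⟨ i , 1F ⟩} λ _ ()))
                     (Span-sum alternating {us = λ j → A₁ ⟨ i , 2+ j ⟩} λ j →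
                       column {d = ⟨ i , 2+ j ⟩} λ _ ()))
        λ r → trans
          (solve 6 (λ x c a b K S → let t = x :+ con 1ℤ ; g = K :+ con 1ℤ :- t
                                        q = :- (t :* g :+ (K :+ con 1ℤ)) in
             t :* c :- t :* a :+ b :+ S :=
             con 1ℤ :* (t :* c :- q :* b) :+ (:- t :* (a :+ g :* b) :+ (S :+ K :* (:- b))))
             refl x (e center r) (e ⟨ i , 0F ⟩ r) (e ⟨ i , 1F ⟩ r) K (tails i r))
          (+-congˡ (+-congˡ (sym (tails-A₁ i r)))))
      λ { center ≢ r → refl ; ⟨ i , 0F ⟩ ≢ r → ⊥-elim (≢ i ≡.refl)
        ; ⟨ i , 1F ⟩ ≢ r → refl ; ⟨ i , 2+ j ⟩ ≢ r → refl }

    -- The value of `g` is fixed here: g - K = 1 - t is the diagonal entry of J - tI.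
    step₁₀ : form A₁₀ ≈ form A₉
    step₁₀ = adjust-columns (suc m) (inner 1F) inner-injective A₉ A₁₀
      (λ i → by (Span-sum alternating {us = λ j → A₁ ⟨ i , 2+ j ⟩} λ j → column {d = ⟨ i , 2+ j ⟩} λ _ ())
        λ r → trans
          (solve 5 (λ x a b K S → let t = x :+ con 1ℤ ; g = K :+ con 1ℤ :- t in
             a :+ b :+ S :- t :* b := con 1ℤ :* (a :+ g :* b) :+ (S :+ K :* (:- b)))
             refl x (e ⟨ i , 0F ⟩ r) (e ⟨ i , 1F ⟩ r) K (tails i r))
          (+-congˡ (sym (tails-A₁ i r))))
      λ { center ≢ r → refl ; ⟨ i , 0F ⟩ ≢ r → refl
        ; ⟨ i , 1F ⟩ ≢ r → ⊥-elim (≢ i ≡.refl) ; ⟨ i , 2+ j ⟩ ≢ r → refl }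

    step₁₁ : form A₁₁ ≈ (- t) ^ (suc m ℕ.* p) * form A₁₀
    step₁₁ = replace-columns alternating (suc m ℕ.* p) outer outer-injective {A₁₀} {A₁₁} (- t)
      (λ y → by (column {d = ⟨ proj₁ (remQuot {suc m} p y) , 1F ⟩} λ _ ())
        λ r → solve 5 (λ a b c S t → a :+ b :+ S :- t :* c := :- t :* (c :- b) :+ (a :+ b :+ S :- t :* b))
          refl _ _ _ _ t)
      λ { center ≢ r → refl ; ⟨ i , 0F ⟩ ≢ r → refl ; ⟨ i , 1F ⟩ ≢ r → refl
        ; ⟨ i , 2+ j ⟩ ≢ r → ⊥-elim (≢ _ (outer-combine i j)) }

    -- Restores the column of v₀₀ that was subtracted from the core columns; its own entry turns
    -- from `t` into t - x = 1.
    step₁₂ : form A₁₂ ≈ form A₁₁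
    step₁₂ = adjust-columns (suc m) (inner 0F) inner-injective A₁₁ A₁₂
      (λ i → by (column {d = center} λ _ ())
        λ r → solve 6 (λ x c a b S T → let t = x :+ con 1ℤ in
          c :+ S :+ b :+ T :- t :* a := con 1ℤ :* (t :* c :- t :* a :+ b :+ T) :+ (:- x :* c :+ S))
          refl x (e center r) (e ⟨ i , 0F ⟩ r) (e ⟨ i , 1F ⟩ r) (sum (λ i → e ⟨ i , 0F ⟩ r)) (tails i r))
      λ { center ≢ r → refl ; ⟨ i , 0F ⟩ ≢ r → ⊥-elim (≢ i ≡.refl)
        ; ⟨ i , 1F ⟩ ≢ r → refl ; ⟨ i , 2+ j ⟩ ≢ r → refl }

  reduction : form A₁₂ ≈ (- t) ^ (suc m ℕ.* p) * (q ^ m * ((- x * q - (M + ι 1ℤ) * g * t) * form e))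
  reduction = begin
    form A₁₂   ≈⟨ trans step₁₂ step₁₁ ⟩
    (- t) ^ (suc m ℕ.* p) * form A₁₀
      ≈⟨ *-congˡ (trans step₁₀ (trans step₉ step₈)) ⟩
    (- t) ^ (suc m ℕ.* p) * (q ^ m * form A₇)
      ≈⟨ *-congˡ (*-congˡ (trans step₇ step₆)) ⟩
    (- t) ^ (suc m ℕ.* p) * (q ^ m * ((- x * q - (M + ι 1ℤ) * g * t) * form A₅))
      ≈⟨ *-congˡ (*-congˡ (*-congˡ (trans step₅ (trans step₄ (trans step₃ (trans step₂ step₁)))))) ⟩
    (- t) ^ (suc m ℕ.* p) * (q ^ m * ((- x * q - (M + ι 1ℤ) * g * t) * form e)) ∎

-- The adjacency matrix of the sunflower

_≟ⱽ_ : ∀ {m n} → DecidableEquality (Vertex m n)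
_≟ⱽ_ = Maybe.≡-dec (×.≡-dec _≟_ _≟_)

Vertex↔Fin : ∀ m n → Fin (suc (m ℕ.* n)) ↔ Vertex m n
Vertex↔Fin m n = mk↔ₛ′ to from to∘from from∘to
  where
  to : Fin (suc (m ℕ.* n)) → Vertex m n
  to zero    = center
  to (suc y) = just (remQuot n y)
  from : Vertex m n → Fin (suc (m ℕ.* n))
  from center    = zero
  from ⟨ i , j ⟩ = suc (combine i j)
  to∘from : ∀ a → to (from a) ≡ a
  to∘from center    = ≡.refl
  to∘from ⟨ i , j ⟩ = ≡.cong just (remQuot-combine i j)
  from∘to : ∀ y → from (to y) ≡ y
  from∘to zero    = ≡.refl
  from∘to (suc y) = ≡.cong suc (combine-remQuot {m} n y)

module SunflowerDeterminant {a ℓ} (R : CommutativeRing a ℓ) (ι-homo : ℤ-algebra R)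
  (p : ℕ) (2≤k : 2 ≤ suc (suc p)) (x : CommutativeRing.Carrier R) where
  open CommutativeRing R hiding (zero)
  open RingProperties ring
  open Sum semiring
  open Exp semiring using (_^_; ^-homo-*; ^-congˡ)
  open SetoidReasoning setoid
  open MultilinearForms R
  open DeterminantProperties R
  open _-Raw-AlmostCommutative⟶_ ι-homo renaming (⟦_⟧ to ι)
  open Determinant rawRing renaming (det to ∣_∣)

  open ℤ-AlgebraSolver R ι-homo
    using (solve; _:=_; _:+_; _:*_; _:-_; :-_; _:^_; con)

  private
    k : ℕ
    k = suc (suc p)
    V : Set
    V = Vertex (suc p) k
    G = sunflower k 2≤k
    open Hypergraph G using (order; edges)

  open Inverse (Vertex↔Fin (suc p) k) using (to; from; strictlyInverseˡ; strictlyInverseʳ)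

  e : V → V → Carrier
  e = δ _≟ⱽ_

  -- For k = p + 2 there are p + 1 petals of p + 2 vertices, so both parameters are `p`.
  open SunflowerColumns R ι-homo p p e x
  open SunflowerReduction R ι-homo p p e x (reindexed-det _≟ⱽ_ (Vertex↔Fin (suc p) k))
    (reindexed-det-alternating _≟ⱽ_ (Vertex↔Fin (suc p) k))

  -- Entries of the last family as edge counts

  private
    [_] : Bool → Carrier
    [ b ] = if b then 1# else 0#

    e-product : ∀ i j i′ j′ → e ⟨ i , j ⟩ ⟨ i′ , j′ ⟩ ≈ δ _≟_ i i′ * δ _≟_ j j′
    e-product i j i′ j′ with i ≟ i′
    ... | yes ≡.refl = sym (*-identityˡ _)
    ... | no _       = sym (zeroˡ _)

    sum-δ : ∀ {n} (u : Fin n → Carrier) i → sum (λ l → δ _≟_ l i * u l) ≈ u i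
    sum-δ u zero    = trans (+-cong (*-identityˡ _) (sum-zero _ λ l → zeroˡ (u (suc l)))) (+-identityʳ _)
    sum-δ u (suc i) = trans (+-cong (zeroˡ _) (sum-δ (u ∘ suc) i)) (+-identityˡ _)

    χ-core : V → Carrier
    χ-core center    = 1#
    χ-core ⟨ i , j ⟩ = δ _≟_ zero j

    χ-petal : Fin (suc p) → V → Carrier
    χ-petal l center    = 0#
    χ-petal l ⟨ i , j ⟩ = δ _≟_ l i

    -- The product of the incidence matrix with its transpose: an edge contains both vertices
    -- exactly when its two indicators have product 1.
    common-edges : V → V → Carrier
    common-edges a b = χ-core a * χ-core b + sum (λ l → χ-petal l a * χ-petal l b)

    core-column : ∀ a → e center a + sum (λ i → e ⟨ i , 0F ⟩ a) ≈ χ-core a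
    core-column center = trans (+-congˡ (sum-zero (λ i → e ⟨ i , 0F ⟩ center) λ _ → refl)) (+-identityʳ 1#)
    core-column ⟨ i′ , j′ ⟩ = begin
      0# + sum (λ i → e ⟨ i , 0F ⟩ ⟨ i′ , j′ ⟩)              ≈⟨ +-identityˡ _ ⟩
      sum (λ i → e ⟨ i , 0F ⟩ ⟨ i′ , j′ ⟩)                   ≈⟨ sum-cong-≋ (λ i → e-product i 0F i′ j′) ⟩
      sum {suc p} (λ i → δ _≟_ i i′ * δ {Fin k} _≟_ zero j′) ≈⟨ sum-δ (λ _ → δ _≟_ zero j′) i′ ⟩
      δ _≟_ zero j′ ∎

    petal-column : ∀ i a → sum (λ j → e ⟨ i , j ⟩ a) ≈ χ-petal i a
    petal-column i center = sum-zero (λ j → e ⟨ i , j ⟩ center) λ _ → refl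
    petal-column i ⟨ i′ , j′ ⟩ = begin
      sum (λ j → e ⟨ i , j ⟩ ⟨ i′ , j′ ⟩)                ≈⟨ sum-cong-≋ (λ j →
                                                              trans (e-product i j i′ j′) (*-comm (δ _≟_ i i′) (δ _≟_ j j′))) ⟩
      sum {k} (λ j → δ _≟_ j j′ * δ {Fin (suc p)} _≟_ i i′)  ≈⟨ sum-δ (λ _ → δ _≟_ i i′) j′ ⟩
      δ _≟_ i i′ ∎

    -- Degree plus `x`: the diagonal of `common-edges` holds the degrees, where that of the
    -- adjacency matrix is 0.
    weight : V → Carrier
    weight center        = t
    weight ⟨ i , 0F ⟩    = ι 1ℤ + t
    weight ⟨ i , suc j ⟩ = t

    common-edges-center : ∀ a → common-edges a center ≈ χ-core a
    common-edges-center a = trans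
      (+-cong (*-identityʳ (χ-core a)) (sum-zero (λ l → χ-petal l a * 0#) λ l → zeroʳ (χ-petal l a)))
      (+-identityʳ (χ-core a))

    common-edges-petal : ∀ a i j → common-edges a ⟨ i , j ⟩ ≈ χ-core a * δ _≟_ zero j + χ-petal i a
    common-edges-petal a i j = +-congˡ (trans
      (sum-cong-≋ λ l → *-comm (χ-petal l a) (δ _≟_ l i))
      (sum-δ (λ l → χ-petal l a) i))

    inner-edges : ∀ a i → (e center a + sum (λ i → e ⟨ i , 0F ⟩ a)) + sum (λ j → e ⟨ i , j ⟩ a) ≈
                  common-edges a ⟨ i , 0F ⟩
    inner-edges a i = trans
      (+-cong (trans (core-column a) (sym (*-identityʳ (χ-core a)))) (petal-column i a))
      (sym (common-edges-petal a i 0F))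

    outer-edges : ∀ a i j → sum (λ j → e ⟨ i , j ⟩ a) ≈ common-edges a ⟨ i , suc j ⟩
    outer-edges a i j = begin
      sum (λ j → e ⟨ i , j ⟩ a)        ≈⟨ petal-column i a ⟩
      χ-petal i a                      ≈⟨ trans (+-congʳ (zeroʳ (χ-core a))) (+-identityˡ (χ-petal i a)) ⟨
      χ-core a * 0# + χ-petal i a      ≈⟨ common-edges-petal a i (suc j) ⟨
      common-edges a ⟨ i , suc j ⟩ ∎

    -congʳ-trans : ∀ {u v w z} → u ≈ v - z → v ≈ w → u ≈ w - z
    -congʳ-trans u≈v-z v≈w = trans u≈v-z (+-congʳ v≈w)

    A₁₂-entry : ∀ a b → A₁₂ b a ≈ common-edges a b - weight b * e b a
    A₁₂-entry a center        = -congʳ-trans (A₁₂-center a) (trans (core-column a) (sym (common-edges-center a)))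
    A₁₂-entry a ⟨ i , 0F ⟩    = -congʳ-trans (A₁₂-inner i a) (inner-edges a i)
    A₁₂-entry a ⟨ i , suc j ⟩ = -congʳ-trans (A₁₂-outer i j a) (outer-edges a i j)

    Indicates : Carrier → Set → Set ℓ
    Indicates y P = (P × y ≈ 1#) ⊎ (¬ P × y ≈ 0#)

    core-indicator : ∀ b → Indicates (χ-core b) (from b ∈ core k 2≤k)
    core-indicator center        = inj₁ (x∈p∪q⁺ (inj₁ (x∈⁅x⁆ (v₀₀ k))) , refl)
    core-indicator ⟨ i , zero ⟩  = inj₁ (x∈p∪q⁺ (inj₂ (∈-image⁺ (λ i → v k i zero) i)) , refl)
    core-indicator ⟨ i , suc j ⟩ = inj₂ (∉core , refl)
      where
      ∉core : from ⟨ i , suc j ⟩ ∉ core k 2≤k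
      ∉core ∈core with x∈p∪q⁻ ⁅ v₀₀ k ⁆ _ ∈core
      ... | inj₁ ∈center with () ← x∈⁅y⁆⇒x≡y (v₀₀ k) ∈center
      ... | inj₂ ∈spokes with ∈-image⁻ (λ i → v k i zero) ∈spokes
      ...   | i′ , eq with () ← combine-injectiveʳ i (suc j) i′ zero (suc-injective eq)

    petal-indicator : ∀ l b → Indicates (χ-petal l b) (from b ∈ petal k l)
    petal-indicator l center = inj₂ (∉petal , refl)
      where
      ∉petal : from center ∉ petal k l
      ∉petal ∈petal with ∈-image⁻ (v k l) ∈petal
      ... | _ , ()
    petal-indicator l ⟨ i , j ⟩ with l ≟ i
    ... | yes ≡.refl = inj₁ (∈-image⁺ (v k l) j , refl)
    ... | no l≢i     = inj₂ (∉petal , refl)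
      where
      ∉petal : from ⟨ i , j ⟩ ∉ petal k l
      ∉petal ∈petal with ∈-image⁻ (v k l) ∈petal
      ... | j′ , eq = l≢i (≡.sym (combine-injectiveˡ i j l j′ (suc-injective eq)))

    pair⊆-indicator : ∀ {n} (s : Subset n) {b c y z} → Indicates y (b ∈ s) → Indicates z (c ∈ s) →
                      [ does ((⁅ b ⁆ ∪ ⁅ c ⁆) ⊆? s) ] ≈ y * z
    pair⊆-indicator s {b} {c} y-ind z-ind with (⁅ b ⁆ ∪ ⁅ c ⁆) ⊆? s | y-ind | z-ind
    ... | yes b,c⊆s | inj₁ (_ , y≈1)   | inj₁ (_ , z≈1)   = sym (trans (*-cong y≈1 z≈1) (*-identityˡ 1#))
    ... | yes b,c⊆s | inj₂ (b∉s , _)   | _                = ⊥-elim (b∉s (b,c⊆s (x∈p∪q⁺ (inj₁ (x∈⁅x⁆ b)))))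
    ... | yes b,c⊆s | inj₁ _           | inj₂ (c∉s , _)   = ⊥-elim (c∉s (b,c⊆s (x∈p∪q⁺ (inj₂ (x∈⁅x⁆ c)))))
    ... | no b,c⊈s  | inj₁ (b∈s , _)   | inj₁ (c∈s , _)   = ⊥-elim (b,c⊈s ⊆s)
      where
      ⊆s : ⁅ b ⁆ ∪ ⁅ c ⁆ ⊆ s
      ⊆s {d} d∈ with x∈p∪q⁻ ⁅ b ⁆ ⁅ c ⁆ d∈
      ... | inj₁ d∈b = ≡.subst (_∈ s) (≡.sym (x∈⁅y⁆⇒x≡y b d∈b)) b∈s
      ... | inj₂ d∈c = ≡.subst (_∈ s) (≡.sym (x∈⁅y⁆⇒x≡y c d∈c)) c∈s
    ... | no b,c⊈s  | inj₂ (_ , y≈0)   | _                = sym (trans (*-congʳ y≈0) (zeroˡ _))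
    ... | no b,c⊈s  | inj₁ _           | inj₂ (_ , z≈0)   = sym (trans (*-congˡ z≈0) (zeroʳ _))

    ι-length-filter-∷ : ∀ {A : Set} {P : Pred A 0ℓ} (P? : Decidable P) y ys →
                        ι (+ length (filter P? (y ∷ ys))) ≈ [ does (P? y) ] + ι (+ length (filter P? ys))
    ι-length-filter-∷ P? y ys with P? y
    ... | yes _ = trans (+-homo 1ℤ _) (+-congʳ 1-homo)
    ... | no _  = sym (+-identityˡ _)

    ι-length-filter : ∀ {A : Set} {P : Pred A 0ℓ} (P? : Decidable P) {n} (h : Fin n → A) →
                      ι (+ length (filter P? (tabulate h))) ≈ sum (λ i → [ does (P? (h i)) ])
    ι-length-filter P? {ℕ.zero} h = 0-homo
    ι-length-filter P? {suc n}  h =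
      trans (ι-length-filter-∷ P? (h zero) _) (+-congˡ (ι-length-filter P? (h ∘ suc)))

    count-common-edges : ∀ b c →
      ι (+ length (filter ((⁅ from b ⁆ ∪ ⁅ from c ⁆) ⊆?_) edges)) ≈ common-edges b c
    count-common-edges b c = trans (ι-length-filter-∷ P? (core k 2≤k) _) (+-cong
      (pair⊆-indicator (core k 2≤k) (core-indicator b) (core-indicator c))
      (trans (ι-length-filter P? (petal k))
             (sum-cong-≋ λ l → pair⊆-indicator (petal k l) (petal-indicator l b) (petal-indicator l c))))
      where P? = (⁅ from b ⁆ ∪ ⁅ from c ⁆) ⊆?_

    e-diagonal : ∀ b → e b b ≈ 1#
    e-diagonal b with b ≟ⱽ b
    ... | yes _  = refl
    ... | no b≢b = ⊥-elim (b≢b ≡.refl)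

    e-off-diagonal : ∀ {b c} → b ≢ c → e b c ≈ 0#
    e-off-diagonal {b} {c} b≢c with b ≟ⱽ c
    ... | yes b≡c = ⊥-elim (b≢c b≡c)
    ... | no _    = refl

    A₁₂-diagonal : ∀ b → A₁₂ b b ≈ - x
    A₁₂-diagonal b = begin
      A₁₂ b b                              ≈⟨ A₁₂-entry b b ⟩
      common-edges b b - weight b * e b b  ≈⟨ +-congˡ (-‿cong (trans (*-congˡ (e-diagonal b)) (*-identityʳ _))) ⟩
      common-edges b b - weight b          ≈⟨ diagonal b ⟩
      - x ∎
      where
      δ-diagonal : ∀ {n} (i : Fin n) → δ _≟_ i i ≈ ι 1ℤ
      δ-diagonal i with i ≟ i
      ... | yes _  = sym 1-homo
      ... | no i≢i = ⊥-elim (i≢i ≡.refl)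
      diagonal : ∀ b → common-edges b b - weight b ≈ - x
      diagonal center = trans
        (+-congʳ (trans (common-edges-center center) (sym 1-homo)))
        (solve 1 (λ x → con 1ℤ :- (x :+ con 1ℤ) := :- x) refl x)
      diagonal ⟨ i , 0F ⟩ = trans
        (+-congʳ (trans (common-edges-petal ⟨ i , 0F ⟩ i 0F)
          (+-cong (trans (*-identityˡ 1#) (sym 1-homo)) (δ-diagonal i))))
        (solve 1 (λ x → con 1ℤ :+ con 1ℤ :- (con 1ℤ :+ (x :+ con 1ℤ)) := :- x) refl x)
      diagonal ⟨ i , suc j ⟩ = trans
        (+-congʳ (trans (common-edges-petal ⟨ i , suc j ⟩ i (suc j))
          (trans (+-cong (zeroˡ 0#) (δ-diagonal i)) (+-identityˡ _))))
        (solve 1 (λ x → con 1ℤ :- (x :+ con 1ℤ) := :- x) refl x)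

    entry : ∀ r c → ι (adjacency G r c) - x * ι (identity r c) ≈ A₁₂ (to c) (to r)
    entry r c with r ≟ c
    ... | yes ≡.refl = begin
      ι 0ℤ - x * ι 1ℤ    ≈⟨ solve 1 (λ x → con 0ℤ :- x :* con 1ℤ := :- x) refl x ⟩
      - x                ≈⟨ A₁₂-diagonal (to r) ⟨
      A₁₂ (to r) (to r) ∎
    ... | no r≢c = begin
      ι (count r c) - x * ι 0ℤ
        ≈⟨ solve 2 (λ n x → n :- x :* con 0ℤ := n) refl _ x ⟩
      ι (count r c)
        ≡⟨ ≡.cong₂ (λ r c → ι (count r c)) (strictlyInverseʳ r) (strictlyInverseʳ c) ⟨
      ι (count (from (to r)) (from (to c)))
        ≈⟨ count-common-edges (to r) (to c) ⟩
      common-edges (to r) (to c)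
        ≈⟨ trans (+-congˡ (trans (-‿cong (trans (*-congˡ (e-off-diagonal to≢)) (zeroʳ _))) -0#≈0#)) (+-identityʳ _) ⟨
      common-edges (to r) (to c) - weight (to c) * e (to c) (to r)
        ≈⟨ A₁₂-entry (to r) (to c) ⟨
      A₁₂ (to c) (to r) ∎
      where
      count : Fin order → Fin order → ℤ
      count r c = + length (filter ((⁅ r ⁆ ∪ ⁅ c ⁆) ⊆?_) edges)
      to≢ : to c ≢ to r
      to≢ eq = r≢c (≡.sym (to-injective _≟ⱽ_ (Vertex↔Fin (suc p) k) eq))

    -- The exponent n (n + 1) is even.
    ^-even : ∀ y n → (- y) ^ (suc n ℕ.* n) ≈ y ^ (suc n ℕ.* n)
    ^-even y ℕ.zero  = refl
    ^-even y (suc n) = begin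
      (- y) ^ (suc (suc n) ℕ.* suc n)   ≈⟨ split (- y) ⟩
      (- y) ^ (suc n ℕ.* n) * ((- y) ^ suc n * (- y) ^ suc n)   ≈⟨ *-cong (^-even y n) (square (suc n)) ⟩
      y ^ (suc n ℕ.* n) * (y ^ suc n * y ^ suc n)   ≈⟨ split y ⟨
      y ^ (suc (suc n) ℕ.* suc n) ∎
      where
      arithmetic : ∀ n → suc (suc n) ℕ.* suc n ≡ suc n ℕ.* n ℕ.+ (suc n ℕ.+ suc n)
      arithmetic = solve-∀
      split : ∀ z → z ^ (suc (suc n) ℕ.* suc n) ≈ z ^ (suc n ℕ.* n) * (z ^ suc n * z ^ suc n)
      split z = begin
        z ^ (suc (suc n) ℕ.* suc n)                     ≡⟨ ≡.cong (z ^_) (arithmetic n) ⟩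
        z ^ (suc n ℕ.* n ℕ.+ (suc n ℕ.+ suc n))         ≈⟨ ^-homo-* z (suc n ℕ.* n) _ ⟩
        z ^ (suc n ℕ.* n) * z ^ (suc n ℕ.+ suc n)       ≈⟨ *-congˡ (^-homo-* z (suc n) (suc n)) ⟩
        z ^ (suc n ℕ.* n) * (z ^ suc n * z ^ suc n) ∎
      square : ∀ n → (- y) ^ n * (- y) ^ n ≈ y ^ n * y ^ n
      square ℕ.zero  = refl
      square (suc n) = begin
        (- y * (- y) ^ n) * (- y * (- y) ^ n)
          ≈⟨ solve 2 (λ y w → (:- y :* w) :* (:- y :* w) := y :* y :* (w :* w)) refl y _ ⟩
        y * y * ((- y) ^ n * (- y) ^ n)       ≈⟨ *-congˡ (square n) ⟩
        y * y * (y ^ n * y ^ n)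
          ≈⟨ solve 2 (λ y w → y :* y :* (w :* w) := (y :* w) :* (y :* w)) refl y _ ⟩
        (y * y ^ n) * (y * y ^ n) ∎

    ^-neg : ∀ y n → (- y) ^ n ≈ ι (-1ℤ ℤ.^ n) * y ^ n
    ^-neg y ℕ.zero  = sym (trans (*-identityʳ _) 1-homo)
    ^-neg y (suc n) = begin
      - y * (- y) ^ n                                ≈⟨ *-congˡ (^-neg y n) ⟩
      - y * (ι (-1ℤ ℤ.^ n) * y ^ n)                  ≈⟨ solve 3 (λ y s w → :- y :* (s :* w) := (con -1ℤ :* s) :* (y :* w))
                                                          refl y _ _ ⟩
      (ι -1ℤ * ι (-1ℤ ℤ.^ n)) * (y * y ^ n)          ≈⟨ *-congʳ (*-homo -1ℤ (-1ℤ ℤ.^ n)) ⟨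
      ι (-1ℤ ℤ.* -1ℤ ℤ.^ n) * (y * y ^ n) ∎

    -- Comparison of the factors with the stated polynomials

    κ : ℤ
    κ = + k

    cubic quadratic : Carrier
    cubic = ι ((+ 2) ℤ.- (+ 3) ℤ.* κ ℤ.+ κ ℤ.^ 2)
          + ι ((+ 6) ℤ.- (+ 6) ℤ.* κ ℤ.+ κ ℤ.^ 2) * x
          + ι ((+ 4) ℤ.- (+ 2) ℤ.* κ) * x ^ 2
          + x ^ 3
    quadratic = ι (ℤ.- (+ 3) ℤ.+ (+ 2) ℤ.* κ) + ι (κ ℤ.- (+ 3)) * x - x ^ 2

    -- The stated coefficients are integers computed from `κ`, while the reduction speaks of `K`;
    -- the expansions of `ι` below make them polynomials in `K` for the solver.
    ι-κ : ι κ ≈ ι (+ 2) + K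
    ι-κ = +-homo (+ 2) (+ p)

    ι-affine : ∀ a b → ι (a ℤ.+ b ℤ.* κ) ≈ ι a + ι b * (ι (+ 2) + K)
    ι-affine a b = trans (+-homo a _) (+-congˡ (trans (*-homo b κ) (*-congˡ ι-κ)))

    ι-affine- : ∀ a b → ι (a ℤ.- b ℤ.* κ) ≈ ι a - ι b * (ι (+ 2) + K)
    ι-affine- a b = trans (+-homo a _) (+-congˡ (trans (-‿homo _) (-‿cong (trans (*-homo b κ) (*-congˡ ι-κ)))))

    ι-quadratic : ∀ a b → ι (a ℤ.- b ℤ.* κ ℤ.+ κ ℤ.^ 2) ≈
                  ι a - ι b * (ι (+ 2) + K) + (ι (+ 2) + K) * (ι (+ 2) + K)
    ι-quadratic a b = trans (+-homo (a ℤ.- b ℤ.* κ) (κ ℤ.^ 2)) (+-cong (ι-affine- a b)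
      -- `κ ℤ.^ 2` unfolds to `κ ℤ.* (κ ℤ.* 1ℤ)`.
      (trans (reflexive (≡.cong (λ z → ι (κ ℤ.* z)) (ℤ.*-identityʳ κ))) (trans (*-homo κ κ) (*-cong ι-κ ι-κ))))

    q≈-quadratic : q ≈ - quadratic
    q≈-quadratic = trans
      (solve 2 (λ x K → let t = x :+ con 1ℤ ; g = K :+ con 1ℤ :- t ; κ = con (+ 2) :+ K in
         :- (t :* g :+ (K :+ con 1ℤ)) :=
         :- ((con (ℤ.- (+ 3)) :+ con (+ 2) :* κ) :+ (κ :- con (+ 3)) :* x :- x :^ 2)) refl x K)
      (-‿cong (sym (+-congʳ (+-cong (ι-affine (ℤ.- (+ 3)) (+ 2))
        (*-congʳ (trans (+-homo κ _) (+-cong ι-κ (-‿homo (+ 3)))))))))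

    linear-factor≈-cubic : - x * q - (M + ι 1ℤ) * g * t ≈ - cubic
    linear-factor≈-cubic = trans
      (solve 2 (λ x K → let t = x :+ con 1ℤ ; g = K :+ con 1ℤ :- t ; κ = con (+ 2) :+ K
                            q = :- (t :* g :+ (K :+ con 1ℤ)) in
         :- x :* q :- (K :+ con 1ℤ) :* g :* t :=
         :- (con (+ 2) :- con (+ 3) :* κ :+ κ :* κ
             :+ (con (+ 6) :- con (+ 6) :* κ :+ κ :* κ) :* x
             :+ (con (+ 4) :- con (+ 2) :* κ) :* x :^ 2
             :+ x :^ 3)) refl x K)
      (-‿cong (sym (+-congʳ (+-cong (+-cong (ι-quadratic (+ 2) (+ 3))
        (*-congʳ (ι-quadratic (+ 6) (+ 6)))) (*-congʳ (ι-affine- (+ 4) (+ 2)))))))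

  private
    Φ : MultilinearForm V V
    Φ = reindexed-det _≟ⱽ_ (Vertex↔Fin (suc p) k)

  -- The power of `- t` has an even exponent and loses its sign. Each of the `p` factors `q` is
  -- minus the quadratic and the remaining factor is minus the cubic, which gives p + 1 signs.
  determinant : ∣ (λ r c → ι (adjacency G r c) - x * ι (identity r c)) ∣ ≈
    ι (-1ℤ ℤ.^ suc p) * (ι (+ 1) + x) ^ (suc p ℕ.* p) * cubic * quadratic ^ p
  determinant = begin
    ∣ (λ r c → ι (adjacency G r c) - x * ι (identity r c)) ∣
      ≈⟨ det-cong entry ⟩
    ∣ (λ r c → A₁₂ (to c) (to r)) ∣
      ≈⟨ reduction ⟩
    (- t) ^ N * (q ^ p * ((- x * q - (M + ι 1ℤ) * g * t) * MultilinearForm.form Φ e))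
      ≈⟨ *-cong (trans (^-even t p) (^-congˡ N (+-comm x (ι 1ℤ))))
           (*-cong (trans (^-congˡ p q≈-quadratic) (^-neg quadratic p))
             (trans (*-congˡ (reindexed-det-identity _≟ⱽ_ (Vertex↔Fin (suc p) k)))
                    (trans (*-identityʳ _) linear-factor≈-cubic))) ⟩
    (ι 1ℤ + x) ^ N * (ι (-1ℤ ℤ.^ p) * quadratic ^ p * (- cubic))
      ≈⟨ solve 4 (λ T s Q P → T :* (s :* Q :* (:- P)) := con -1ℤ :* s :* T :* P :* Q) refl _ _ _ _ ⟩
    ι -1ℤ * ι (-1ℤ ℤ.^ p) * (ι 1ℤ + x) ^ N * cubic * quadratic ^ p
      ≈⟨ *-congʳ (*-congʳ (*-congʳ (*-homo -1ℤ (-1ℤ ℤ.^ p)))) ⟨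
    ι (-1ℤ ℤ.^ suc p) * (ι 1ℤ + x) ^ N * cubic * quadratic ^ p ∎
    where N = suc p ℕ.* p

open import Data.Nat using (_∸_) renaming (_*_ to _*ℕ_)
open import Data.Integer using (-_; _+_; _-_; _*_; _^_)

-- The sign, absent from the formula in words, is forced by leading coefficients: the order k(k-1)+1
-- is odd, so that of det (A - λI) is -1, while the remaining factors together give (-1)^(k-2). For
-- k = 2 the determinant is -λ³ + 2λ and the cubic is λ³ - 2λ.
theorem6p1 : (k : ℕ) (2≤k : 2 ≤ k) →
    let κ = + k in
    charPoly (adjacency (sunflower k 2≤k))
    ≈ₚ
    C (-1ℤ ^ (k ∸ 1))
    *ₚ (C (+ 1) +ₚ X) ^ₚ ((k ∸ 1) *ℕ (k ∸ 2))
    *ₚ (C ((+ 2) - (+ 3) * κ + κ ^ 2)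
    +ₚ C ((+ 6) - (+ 6) * κ + κ ^ 2) *ₚ X
    +ₚ C ((+ 4) - (+ 2) * κ) *ₚ X ^ₚ 2
    +ₚ X ^ₚ 3)
    *ₚ (C (- (+ 3) + (+ 2) * κ) +ₚ C (κ - (+ 3)) *ₚ X -ₚ X ^ₚ 2) ^ₚ (k ∸ 2)
theorem6p1 1             (s≤s ())
theorem6p1 (suc (suc p)) 2≤k =
  SunflowerDeterminant.determinant Polynomials.ℤ[X]-commutativeRing Polynomials.C-homo p 2≤k X
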